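{- Let $B=\left(\frac{e}{\sqrt{2\pi}}\right)^3$. Then the following hold. (1) For all integers $k\ge 1$, $R(3,k)\le \mathrm{TOW}\big(B(k-1)^{1/2},\,2k\big)$. (2) For all integers $k\ge 2$, $R(4,k)\le \mathrm{TOW}\big(1,\,3B(k-2)^{1/2},\,2k-2\big)$. (3) For all integers $k\ge 3$, $R(5,k)\le \mathrm{TOW}\big(1,\,4,\,3B(k-3)^{1/2},\,2k-4\big)$. (4) For every integer $a\ge 6$, for all sufficiently large integers $k$, $$R(a,k)\le \mathrm{TOW}\big(1,\,a-1,\,a-2,\,\ldots,\,4,\,3B(k-a+2)^{1/2},\,2k-2a+6\big),$$ where the arguments following the initial $1$ are the integers $a-1,a-2,\ldots,4$ in decreasing order, followed by $3B(k-a+2)^{1/2}$ and then $2k-2a+6$.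
   Context: For a set $X$ and an integer $a\ge 1$, $\binom{X}{a}$ denotes the set of all $a$-element subsets of $X$, and $[n]=\{1,\dots,n\}$. Given a coloring $COL$ of $\binom{[n]}{a}$, a set $H\subseteq[n]$ is $a$-homogeneous for $COL$ if all elements of $\binom{H}{a}$ have the same color (vacuously true if $|H|<a$). For integers $a,k\ge 1$, $R(a,k)$ denotes the least $n$ such that for every 2-coloring of $\binom{[n]}{a}$ there exists an $a$-homogeneous set $H\subseteq [n]$ with $|H|=k$ (this number exists by Ramsey's theorem). The function $\mathrm{TOW}$ takes a variable number of real arguments and is defined recursively by $\mathrm{TOW}(b)=2^b$ and $\mathrm{TOW}(b_1,\ldots,b_L)=2^{\,b_1\cdot \mathrm{TOW}(b_2,\ldots,b_L)}$ for $L\ge 2$. -}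

module Defs where

open import Algebra.Bundles using (CommutativeRing)
open import Data.Bool.Base using (Bool)
open import Data.Fin.Subset using (Subset; _⊆_; ∣_∣)
open import Data.Integer.Base as ℤ using (ℤ; +_; -[1+_])
import Data.Integer.Properties as ℤ
open import Data.List.Base using (List; []; _∷_)
open import Data.Nat.Base as ℕ using (ℕ; zero; suc; z≤n; s≤s)
import Data.Nat.Properties as ℕ
open import Data.Nat.Coprimality as Coprimality using (1-coprimeTo)
open import Data.Product.Base using (Σ-syntax; ∃₂; ∃-syntax; _×_; _,_; proj₁; proj₂)
open import Data.Rational.Base hiding (∣_∣)
open import Data.Rational.Properties
open import Data.Rational.Solver using (module +-*-Solver)
open import Data.Rational.Unnormalised.Base as ℚᵘ using (mkℚᵘ)
import Data.Rational.Unnormalised.Properties as ℚᵘ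
open import Data.Sum.Base using (_⊎_; inj₁; inj₂)
open import Relation.Binary.PropositionalEquality
  using (_≡_; refl; sym; trans; cong; cong₂; subst; subst₂; module ≡-Reasoning)
open import Relation.Nullary.Decidable.Core using (Dec; yes; no; from-yes)
open import Relation.Nullary.Negation.Core using (¬_)
open import Algebra.Definitions.RawSemiring +-*-rawSemiring using (_^_)
open import Algebra.Properties.CommutativeSemiring.Exp
  (CommutativeRing.commutativeSemiring +-*-commutativeRing)
  using (^-homo-*; ^-assocʳ; ^-distrib-*)

ιℤ : ℤ → ℚ
ιℤ i = mkℚ i 0 (Coprimality.sym (1-coprimeTo ℤ.∣ i ∣))

ι : ℕ → ℚ
ι n = ιℤ (+ n)

1/1+_ : ℕ → ℚ
1/1+ n = 1/ ι (suc n)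

toℚᵘ-ιℤ : ∀ i → toℚᵘ (ιℤ i) ℚᵘ.≃ mkℚᵘ i 0
toℚᵘ-ιℤ i = ℚᵘ.≃-refl

ιℤ-mono : ∀ {i j} → i ℤ.≤ j → ιℤ i ≤ ιℤ j
ιℤ-mono {i} {j} h = *≤* (ℤ.*-monoʳ-≤-nonNeg (+ 1) h)

ιℤ-cancel : ∀ {i j} → ιℤ i ≤ ιℤ j → i ℤ.≤ j
ιℤ-cancel {i} {j} (*≤* h) = subst₂ ℤ._≤_ (ℤ.*-identityʳ i) (ℤ.*-identityʳ j) h

ιℤ-* : ∀ i j → ιℤ (i ℤ.* j) ≡ ιℤ i * ιℤ j
ιℤ-* i j = toℚᵘ-injective (begin
  toℚᵘ (ιℤ (i ℤ.* j))             ≈⟨ toℚᵘ-ιℤ (i ℤ.* j) ⟩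
  mkℚᵘ (i ℤ.* j) 0                ≈⟨ ℚᵘ.*≡* refl ⟩
  mkℚᵘ i 0 ℚᵘ.* mkℚᵘ j 0          ≈⟨ ℚᵘ.*-cong (toℚᵘ-ιℤ i) (toℚᵘ-ιℤ j) ⟨
  toℚᵘ (ιℤ i) ℚᵘ.* toℚᵘ (ιℤ j)    ≈⟨ toℚᵘ-homo-* (ιℤ i) (ιℤ j) ⟨
  toℚᵘ (ιℤ i * ιℤ j)              ∎)
  where open ℚᵘ.≃-Reasoning

ιℤ-+ : ∀ i j → ιℤ (i ℤ.+ j) ≡ ιℤ i + ιℤ j
ιℤ-+ i j = toℚᵘ-injective (begin
  toℚᵘ (ιℤ (i ℤ.+ j))             ≈⟨ toℚᵘ-ιℤ (i ℤ.+ j) ⟩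
  mkℚᵘ (i ℤ.+ j) 0                ≈⟨ ℚᵘ.*≡* (cong (ℤ._* + 1)
                                       (cong₂ ℤ._+_ (sym (ℤ.*-identityʳ i)) (sym (ℤ.*-identityʳ j)))) ⟩
  mkℚᵘ i 0 ℚᵘ.+ mkℚᵘ j 0          ≈⟨ ℚᵘ.+-cong (toℚᵘ-ιℤ i) (toℚᵘ-ιℤ j) ⟨
  toℚᵘ (ιℤ i) ℚᵘ.+ toℚᵘ (ιℤ j)    ≈⟨ toℚᵘ-homo-+ (ιℤ i) (ιℤ j) ⟨
  toℚᵘ (ιℤ i + ιℤ j)              ∎)
  where open ℚᵘ.≃-Reasoning

ιℤ-↥ : ∀ p → ιℤ (↥ p) ≡ p * ιℤ (↧ p)
ιℤ-↥ p@record{} = toℚᵘ-injective (begin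
  toℚᵘ (ιℤ (↥ p))                 ≈⟨ toℚᵘ-ιℤ (↥ p) ⟩
  mkℚᵘ (↥ p) 0                    ≈⟨ ℚᵘ.*≡* (cross) ⟩
  toℚᵘ p ℚᵘ.* mkℚᵘ (↧ p) 0        ≈⟨ ℚᵘ.*-cong (ℚᵘ.≃-refl {toℚᵘ p}) (toℚᵘ-ιℤ (↧ p)) ⟨
  toℚᵘ p ℚᵘ.* toℚᵘ (ιℤ (↧ p))     ≈⟨ toℚᵘ-homo-* p (ιℤ (↧ p)) ⟨
  toℚᵘ (p * ιℤ (↧ p))             ∎)
  where
  open ℚᵘ.≃-Reasoning
  cross : ↥ p ℤ.* (+ (↧ₙ p ℕ.* 1)) ≡ (↥ p ℤ.* ↧ p) ℤ.* + 1
  cross = trans (cong (λ n → ↥ p ℤ.* + n) (ℕ.*-identityʳ (↧ₙ p))) (sym (ℤ.*-identityʳ _))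

ι-mono : ∀ {m n} → m ℕ.≤ n → ι m ≤ ι n
ι-mono h = ιℤ-mono (ℤ.+≤+ h)

0≤ι : ∀ n → 0ℚ ≤ ι n
0≤ι n = ι-mono {0} z≤n

ι-suc : ∀ n → ι (suc n) ≡ ι n + 1ℚ
ι-suc n = trans (cong ι (ℕ.+-comm 1 n)) (ιℤ-+ (+ n) (+ 1))

0<1 : 0ℚ < 1ℚ
0<1 = from-yes (0ℚ <? 1ℚ)

0<½ : 0ℚ < ½
0<½ = from-yes (0ℚ <? ½)

*-nn : ∀ {p q} → 0ℚ ≤ p → 0ℚ ≤ q → 0ℚ ≤ p * q
*-nn {p} {q} 0≤p 0≤q = nonNegative⁻¹ (p * q)
  {{nonNeg*nonNeg⇒nonNeg p {{nonNegative 0≤p}} q {{nonNegative 0≤q}}}}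

*-pos : ∀ {p q} → 0ℚ < p → 0ℚ < q → 0ℚ < p * q
*-pos {p} {q} 0<p 0<q = positive⁻¹ (p * q) {{pos*pos⇒pos p {{positive 0<p}} q {{positive 0<q}}}}

*-monoˡ : ∀ {r p q} → 0ℚ ≤ r → p ≤ q → r * p ≤ r * q
*-monoˡ {r} 0≤r = *-monoˡ-≤-nonNeg r {{nonNegative 0≤r}}

*-monoʳ : ∀ {r p q} → 0ℚ ≤ r → p ≤ q → p * r ≤ q * r
*-monoʳ {r} 0≤r = *-monoʳ-≤-nonNeg r {{nonNegative 0≤r}}

*-mono : ∀ {p q r s} → 0ℚ ≤ p → 0ℚ ≤ s → p ≤ q → r ≤ s → p * r ≤ q * s
*-mono 0≤p 0≤s p≤q r≤s = ≤-trans (*-monoˡ 0≤p r≤s) (*-monoʳ 0≤s p≤q)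

inverse : ∀ {p} → 0ℚ < p → ∃[ r ] 0ℚ < r × r * p ≡ 1ℚ
inverse {p} 0<p = 1/ p , positive⁻¹ (1/ p) {{1/pos⇒pos p}} , *-inverseˡ p
  where instance _ = positive 0<p
                 _ = pos⇒nonZero p

ι-unbounded : ∀ p → ∃[ n ] p ≤ ι n
ι-unbounded (mkℚ i d _) = ℤ.∣ i ∣ ,
  *≤* (subst (ℤ._≤ + ℤ.∣ i ∣ ℤ.* + suc d) (sym (ℤ.*-identityʳ i)) (bound i))
  where
  bound : ∀ i → i ℤ.≤ + ℤ.∣ i ∣ ℤ.* + suc d
  bound (+ n)    = subst (+ n ℤ.≤_) (ℤ.pos-* n (suc d)) (ℤ.+≤+ (ℕ.m≤m*n n (suc d)))
  bound -[1+ n ] = subst (-[1+ n ] ℤ.≤_) (ℤ.pos-* (suc n) (suc d)) ℤ.-≤+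

archimedean : ∀ {ε} → 0ℚ < ε → ∀ K → ∃[ n ] K ≤ ι n * ε
archimedean {ε} 0<ε K with inverse 0<ε
... | r , 0<r , rε≡1 with ι-unbounded (K * r)
...   | n , h = n , (begin
  K            ≡⟨ *-identityʳ K ⟨
  K * 1ℚ       ≡⟨ cong (K *_) rε≡1 ⟨
  K * (r * ε)  ≡⟨ *-assoc K r ε ⟨
  K * r * ε    ≤⟨ *-monoʳ (<⇒≤ 0<ε) h ⟩
  ι n * ε      ∎)
  where open ≤-Reasoning

0<ι : ∀ n → 0ℚ < ι (suc n)
0<ι n = <-≤-trans 0<1 (ι-mono {1} (s≤s z≤n))

0<1/1+ : ∀ n → 0ℚ < 1/1+ n
0<1/1+ n = positive⁻¹ (1/1+ n)

1/1+-inverse : ∀ n → 1/1+ n * ι (suc n) ≡ 1ℚ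
1/1+-inverse n = *-inverseˡ (ι (suc n))

1/1+-anti : ∀ {m n} → m ℕ.≤ n → 1/1+ n ≤ 1/1+ m
1/1+-anti {m} {n} h = *≤* (ℤ.*-monoˡ-≤-nonNeg (+ 1) (ℤ.+≤+ (s≤s h)))

1/1+→0 : ∀ c {ε} → 0ℚ < ε → ∃[ n ] ι c * 1/1+ n ≤ ε
1/1+→0 c {ε} 0<ε with archimedean 0<ε (ι c)
... | n , h = n , *-cancelʳ-≤-pos (ι (suc n)) {{positive (0<ι n)}} (begin
  ι c * 1/1+ n * ι (suc n)    ≡⟨ *-assoc (ι c) (1/1+ n) (ι (suc n)) ⟩
  ι c * (1/1+ n * ι (suc n))  ≡⟨ cong (ι c *_) (1/1+-inverse n) ⟩
  ι c * 1ℚ                    ≡⟨ *-identityʳ (ι c) ⟩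
  ι c                         ≤⟨ h ⟩
  ι n * ε                     ≤⟨ *-monoʳ (<⇒≤ 0<ε) (ι-mono (ℕ.n≤1+n n)) ⟩
  ι (suc n) * ε               ≡⟨ *-comm (ι (suc n)) ε ⟩
  ε * ι (suc n)               ∎)
  where open ≤-Reasoning

p≤p+ε : ∀ p {ε} → 0ℚ ≤ ε → p ≤ p + ε
p≤p+ε p {ε} 0≤ε = subst (_≤ p + ε) (+-identityʳ p) (+-monoʳ-≤ p {0ℚ} {ε} 0≤ε)

quarter : ∀ {ε} → 0ℚ < ε → ∃[ δ ] 0ℚ < δ × (δ + δ) + (δ + δ) ≡ ε
quarter {ε} 0<ε = ½ * (½ * ε) , *-pos 0<½ (*-pos 0<½ 0<ε) ,
  solve 1 (λ e → let d = con ½ :* (con ½ :* e) in (d :+ d) :+ (d :+ d) := e) refl ε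
  where open +-*-Solver

common-bound : ∀ a b → ∃[ M ] a ≤ M × b ≤ M
common-bound a b = a ⊔ b , p≤p⊔q a b , p≤q⊔p a b

shrink : ∀ {ε δ} → 0ℚ < ε → 0ℚ < δ → ∃[ η ] 0ℚ < η × η ≤ ε × η ≤ δ
shrink {ε} {δ} 0<ε 0<δ = ε ⊓ δ , positive-min (⊓-sel ε δ) , p⊓q≤p ε δ , p⊓q≤q ε δ
  where
  positive-min : (ε ⊓ δ ≡ ε) ⊎ (ε ⊓ δ ≡ δ) → 0ℚ < ε ⊓ δ
  positive-min (inj₁ e) = subst (0ℚ <_) (sym e) 0<ε
  positive-min (inj₂ e) = subst (0ℚ <_) (sym e) 0<δ

scale : ∀ {K ε} → 0ℚ ≤ K → 0ℚ < ε → ∃[ η ] 0ℚ < η × K * η ≤ ε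
scale {K} {ε} 0≤K 0<ε with inverse (<-≤-trans {0ℚ} {1ℚ} {1ℚ + K} 0<1 (p≤p+ε 1ℚ 0≤K))
... | r , 0<r , r[1+K]≡1 = r * ε , *-pos 0<r 0<ε , (begin
  K * (r * ε)         ≡⟨ +-identityˡ (K * (r * ε)) ⟨
  0ℚ + K * (r * ε)    ≤⟨ +-monoˡ-≤ (K * (r * ε)) (<⇒≤ (*-pos 0<r 0<ε)) ⟩
  r * ε + K * (r * ε) ≡⟨ solve 3 (λ K r e → r :* e :+ K :* (r :* e) := r :* (con 1ℚ :+ K) :* e) refl K r ε ⟩
  r * (1ℚ + K) * ε    ≡⟨ cong (_* ε) r[1+K]≡1 ⟩
  1ℚ * ε              ≡⟨ *-identityˡ ε ⟩
  ε                   ∎)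
  where
  open ≤-Reasoning
  open +-*-Solver

module _ {M η δ : ℚ} (0≤M : 0ℚ ≤ M) (Mη≤δ : M * η ≤ δ) where
  open ≤-Reasoning
  open +-*-Solver

  small-product : ∀ {c d} → - M ≤ c → c ≤ M → 0ℚ ≤ d → d ≤ η → - δ ≤ c * d × c * d ≤ δ
  small-product {c} {d} -M≤c c≤M 0≤d d≤η =
    (begin
      - δ        ≤⟨ neg-antimono-≤ Md≤δ ⟩
      - (M * d)  ≡⟨ neg-distribˡ-* M d ⟩
      - M * d    ≤⟨ *-monoʳ 0≤d -M≤c ⟩
      c * d      ∎) ,
    ≤-trans (*-monoʳ 0≤d c≤M) Md≤δ
    where
    Md≤δ : M * d ≤ δ
    Md≤δ = ≤-trans (*-monoˡ 0≤M d≤η) Mη≤δ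

  difference : ∀ {p a} → p ≤ a → a ≤ p + η → 0ℚ ≤ a - p × a - p ≤ η
  difference {p} {a} p≤a a≤p+η =
    subst (_≤ a - p) (+-inverseʳ p) (+-monoˡ-≤ (- p) p≤a) ,
    subst (a - p ≤_) (solve 2 (λ p e → p :+ e :- p := e) refl p η) (+-monoˡ-≤ (- p) a≤p+η)

  products-close : ∀ {p r a b} → - M ≤ a → a ≤ M → - M ≤ r → r ≤ M →
    p ≤ a → a ≤ p + η → r ≤ b → b ≤ r + η →
    p * r - (δ + δ) ≤ a * b × a * b ≤ p * r + (δ + δ)
  products-close {p} {r} {a} {b} -M≤a a≤M -M≤r r≤M p≤a a≤ r≤b b≤ =
    (begin
      p * r - (δ + δ)                      ≡⟨ cong (λ z → p * r + z) (neg-distrib-+ δ δ) ⟩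
      p * r + (- δ + - δ)                  ≤⟨ +-monoʳ-≤ (p * r) (+-mono-≤ (proj₁ bounds₁) (proj₁ bounds₂)) ⟩
      p * r + (a * (b - r) + r * (a - p))  ≡⟨ expand ⟩
      a * b                                ∎) ,
    (begin
      a * b                                ≡⟨ expand ⟨
      p * r + (a * (b - r) + r * (a - p))  ≤⟨ +-monoʳ-≤ (p * r) (+-mono-≤ (proj₂ bounds₁) (proj₂ bounds₂)) ⟩
      p * r + (δ + δ)                      ∎)
    where
    bounds₁ : - δ ≤ a * (b - r) × a * (b - r) ≤ δ
    bounds₁ = let 0≤b-r , b-r≤η = difference {r} {b} r≤b b≤ in
      small-product -M≤a a≤M 0≤b-r b-r≤η
    bounds₂ : - δ ≤ r * (a - p) × r * (a - p) ≤ δ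
    bounds₂ = let 0≤a-p , a-p≤η = difference {p} {a} p≤a a≤ in
      small-product -M≤r r≤M 0≤a-p a-p≤η
    expand : p * r + (a * (b - r) + r * (a - p)) ≡ a * b
    expand = solve 4 (λ p r a b → p :* r :+ (a :* (b :- r) :+ r :* (a :- p)) := a :* b) refl p r a b

half : ∀ {ε} → 0ℚ < ε → ∃[ δ ] 0ℚ < δ × δ + δ ≡ ε
half {ε} 0<ε = ½ * ε , *-pos 0<½ 0<ε , solve 1 (λ e → con ½ :* e :+ con ½ :* e := e) refl ε
  where open +-*-Solver

-- A real number is a set of closed rational intervals [p , q], any two of
-- which meet and which contains arbitrarily short ones; classically it is
-- the unique point common to all of them.  This is the definition of
-- Bridges and Vîţă (Techniques of Constructive Analysis, chapter 2).  A
-- set of intervals need not contain every interval around the point.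
-- Any two intervals [p , q] and [r , s] meet iff p ≤ s in either order;
-- in particular p ≤ q.
record ℝ : Set₁ where
  field
    Within : ℚ → ℚ → Set
    meet   : ∀ {p q r s} → Within p q → Within r s → p ≤ s
    narrow : ∀ {ε} → 0ℚ < ε → ∃₂ λ p q → Within p q × q ≤ p + ε

open ℝ public

infix 4 _≤ᴿ_

-- x ≤ y iff no interval of y lies strictly to the left of an interval of x.
_≤ᴿ_ : ℝ → ℝ → Set
x ≤ᴿ y = ∀ {p q r s} → Within x p q → Within y r s → p ≤ s

Positiveᴿ : ℝ → Set
Positiveᴿ x = ∃₂ λ p q → Within x p q × 0ℚ < p

fromℚ : ℚ → ℝ
fromℚ r = record
  { Within = λ p q → p ≡ r × q ≡ r
  ; meet   = λ { (refl , _) (_ , refl) → ≤-refl }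
  ; narrow = λ 0<ε → r , r , (refl , refl) , p≤p+ε r (<⇒≤ 0<ε)
  }

fromℕ : ℕ → ℝ
fromℕ n = fromℚ (ι n)

nested : (lo hi : ℕ → ℚ) →
         (∀ n → lo n ≤ lo (suc n)) → (∀ n → hi (suc n) ≤ hi n) →
         (∀ n → lo n ≤ hi n) →
         (∀ {ε} → 0ℚ < ε → ∃[ n ] hi n ≤ lo n + ε) → ℝ
nested lo hi lo↑ hi↓ lo≤hi gap = record
  { Within = λ p q → ∃[ n ] p ≡ lo n × q ≡ hi n
  ; meet   = λ { (m , refl , _) (n , _ , refl) → begin
      lo m          ≤⟨ up m (ℕ.m≤′m+n m n) ⟩
      lo (m ℕ.+ n)  ≤⟨ lo≤hi (m ℕ.+ n) ⟩
      hi (m ℕ.+ n)  ≤⟨ down n (ℕ.n≤′m+n m n) ⟩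
      hi n          ∎ }
  ; narrow = λ 0<ε → let n , h = gap 0<ε in lo n , hi n , (n , refl , refl) , h
  }
  where
  open ≤-Reasoning
  up : ∀ m {n} → m ℕ.≤′ n → lo m ≤ lo n
  up m ℕ.≤′-refl                = ≤-refl
  up m {suc n} (ℕ.≤′-step m≤n)  = ≤-trans (up m m≤n) (lo↑ n)
  down : ∀ m {n} → m ℕ.≤′ n → hi n ≤ hi m
  down m ℕ.≤′-refl              = ≤-refl
  down m {suc n} (ℕ.≤′-step m≤n) = ≤-trans (hi↓ n) (down m m≤n)

-- Every interval of length at most 1 lies in [- M , M].
Bounds : ℝ → ℚ → Set
Bounds x M = ∀ {p q a} → Within x p q → q ≤ p + 1ℚ → p ≤ a → a ≤ q → - M ≤ a × a ≤ M

bounded : ∀ x → ∃[ M ] 0ℚ ≤ M × Bounds x M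
bounded x with narrow x 0<1
... | p₀ , q₀ , w₀ , _ = M , 0≤M , λ {p} {q} {a} w q≤p+1 p≤a a≤q →
  (begin
    - M                     ≤⟨ neg-antimono-≤ -p₀+1≤M ⟩
    - (- p₀ + 1ℚ)           ≡⟨ solve 1 (λ p → :- (:- p :+ con 1ℚ) := p :- con 1ℚ) refl p₀ ⟩
    p₀ - 1ℚ                 ≤⟨ +-monoˡ-≤ (- 1ℚ) (≤-trans (meet x w₀ w) q≤p+1) ⟩
    p + 1ℚ - 1ℚ             ≡⟨ solve 1 (λ p → p :+ con 1ℚ :- con 1ℚ := p) refl p ⟩
    p                       ≤⟨ p≤a ⟩
    a                       ∎) ,
  (begin
    a        ≤⟨ a≤q ⟩
    q        ≤⟨ q≤p+1 ⟩
    p + 1ℚ   ≤⟨ +-monoˡ-≤ 1ℚ (meet x w w₀) ⟩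
    q₀ + 1ℚ  ≤⟨ q₀+1≤M ⟩
    M        ∎)
  where
  open ≤-Reasoning
  open +-*-Solver
  M = 0ℚ ⊔ ((- p₀ + 1ℚ) ⊔ (q₀ + 1ℚ))
  0≤M : 0ℚ ≤ M
  0≤M = p≤p⊔q 0ℚ ((- p₀ + 1ℚ) ⊔ (q₀ + 1ℚ))
  -p₀+1≤M : - p₀ + 1ℚ ≤ M
  -p₀+1≤M = ≤-trans (p≤p⊔q (- p₀ + 1ℚ) (q₀ + 1ℚ)) (p≤q⊔p 0ℚ ((- p₀ + 1ℚ) ⊔ (q₀ + 1ℚ)))
  q₀+1≤M : q₀ + 1ℚ ≤ M
  q₀+1≤M = ≤-trans (p≤q⊔p (- p₀ + 1ℚ) (q₀ + 1ℚ)) (p≤q⊔p 0ℚ ((- p₀ + 1ℚ) ⊔ (q₀ + 1ℚ)))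

infixl 7 _*ᴿ_

_*ᴿ_ : ℝ → ℝ → ℝ
x *ᴿ y = record { Within = W ; meet = W-meet ; narrow = W-narrow }
  where
  W : ℚ → ℚ → Set
  W s t = ∃₂ λ p q → ∃₂ λ r u → Within x p q × Within y r u ×
          (∀ {a b} → p ≤ a → a ≤ q → r ≤ b → b ≤ u → s ≤ a * b × a * b ≤ t)

  W-meet : ∀ {s t s′ t′} → W s t → W s′ t′ → s ≤ t′
  W-meet (p , q , r , u , x∈ , y∈ , bnd) (p′ , q′ , r′ , u′ , x∈′ , y∈′ , bnd′) =
    ≤-trans
      (proj₁ (bnd  (p≤p⊔q p p′) (⊔-lub (meet x x∈ x∈) (meet x x∈′ x∈))
                   (p≤p⊔q r r′) (⊔-lub (meet y y∈ y∈) (meet y y∈′ y∈))))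
      (proj₂ (bnd′ (p≤q⊔p p p′) (⊔-lub (meet x x∈ x∈′) (meet x x∈′ x∈′))
                   (p≤q⊔p r r′) (⊔-lub (meet y y∈ y∈′) (meet y y∈′ y∈′))))

  module _ {ε δ η Mx My M} (4δ≡ε : (δ + δ) + (δ + δ) ≡ ε) (0≤M : 0ℚ ≤ M)
    (Mx≤M : Mx ≤ M) (My≤M : My ≤ M) (Mη≤δ : M * η ≤ δ) (η≤1 : η ≤ 1ℚ)
    (bx : Bounds x Mx) (by : Bounds y My)
    {p q r u} (x∈ : Within x p q) (q≤ : q ≤ p + η) (y∈ : Within y r u) (u≤ : u ≤ r + η)
    where
    open +-*-Solver

    bnd : ∀ {a b} → p ≤ a → a ≤ q → r ≤ b → b ≤ u →
          p * r - (δ + δ) ≤ a * b × a * b ≤ p * r + (δ + δ)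
    bnd {a} {b} p≤a a≤q r≤b b≤u =
      products-close 0≤M Mη≤δ
        (≤-trans (neg-antimono-≤ Mx≤M) (proj₁ ∣a∣≤Mx)) (≤-trans (proj₂ ∣a∣≤Mx) Mx≤M)
        (≤-trans (neg-antimono-≤ My≤M) (proj₁ ∣r∣≤My)) (≤-trans (proj₂ ∣r∣≤My) My≤M)
        p≤a (≤-trans a≤q q≤) r≤b (≤-trans b≤u u≤)
      where
      ∣a∣≤Mx : - Mx ≤ a × a ≤ Mx
      ∣a∣≤Mx = bx x∈ (≤-trans q≤ (+-monoʳ-≤ p η≤1)) p≤a a≤q
      ∣r∣≤My : - My ≤ r × r ≤ My
      ∣r∣≤My = by y∈ (≤-trans u≤ (+-monoʳ-≤ r η≤1)) ≤-refl (meet y y∈ y∈)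

    short : p * r + (δ + δ) ≤ p * r - (δ + δ) + ε
    short = ≤-reflexive (trans
      (solve 2 (λ z d → z :+ d := z :- d :+ (d :+ d)) refl (p * r) (δ + δ))
      (cong (λ z → p * r - (δ + δ) + z) 4δ≡ε))

    short-interval : ∃₂ λ s t → W s t × t ≤ s + ε
    short-interval = p * r - (δ + δ) , p * r + (δ + δ) , (p , q , r , u , x∈ , y∈ , bnd) , short

  W-narrow : ∀ {ε} → 0ℚ < ε → ∃₂ λ s t → W s t × t ≤ s + ε
  W-narrow 0<ε =
    let Mx , 0≤Mx , bx    = bounded x
        My , _    , by    = bounded y
        M , Mx≤M , My≤M   = common-bound Mx My
        0≤M               = ≤-trans 0≤Mx Mx≤M
        δ , 0<δ , 4δ≡ε    = quarter 0<ε
        η₀ , 0<η₀ , Mη₀≤δ = scale 0≤M 0<δ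
        η , 0<η , η≤η₀ , η≤1 = shrink 0<η₀ 0<1
        p , q , x∈ , q≤   = narrow x 0<η
        r , u , y∈ , u≤   = narrow y 0<η
    in short-interval 4δ≡ε 0≤M Mx≤M My≤M (≤-trans (*-monoˡ 0≤M η≤η₀) Mη₀≤δ) η≤1
         bx by x∈ q≤ y∈ u≤

search : {P : ℕ → Set} → (∀ n → Dec (P n)) → ∀ N → P N → P 0 ⊎ (∃[ n ] ¬ P n × P (suc n))
search P? zero    PN = inj₁ PN
search P? (suc N) PN with P? N
... | yes PN′ = search P? N PN′
... | no ¬PN′ = inj₂ (N , ¬PN′ , PN)

ι-suc-* : ∀ n δ → ι (suc n) * δ ≡ ι n * δ + δ
ι-suc-* n δ = trans (cong (_* δ) (ι-suc n))
  (solve 2 (λ z d → (z :+ con 1ℚ) :* d := z :* d :+ d) refl (ι n) δ)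
  where open +-*-Solver

ι0-* : ∀ δ → ι 0 * δ ≡ 0ℚ
ι0-* δ = *-zeroˡ δ

recip : (x : ℝ) → Positiveᴿ x → ℝ
recip x (p₀ , q₀ , x∈₀ , 0<p₀) = record
  { Within = W
  ; meet   = λ {s} {t} {s′} {t′} → W-meet {s} {t} {s′} {t′}
  ; narrow = W-narrow
  }
  where
  W : ℚ → ℚ → Set
  W s t = ∃₂ λ p q → Within x p q × 0ℚ < p × s * q ≤ 1ℚ × 1ℚ ≤ t * p

  W-meet : ∀ {s t s′ t′} → W s t → W s′ t′ → s ≤ t′
  W-meet {s} {t′ = t′} (p , q , x∈ , 0<p , sq≤1 , _) (p′ , q′ , x∈′ , 0<p′ , _ , 1≤t′p′) =
    *-cancelʳ-≤-pos q {{positive (<-≤-trans 0<p (meet x x∈ x∈))}}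
      (≤-trans sq≤1 (≤-trans 1≤t′p′ (*-monoˡ 0≤t′ (meet x x∈′ x∈))))
    where
    0≤t′ : 0ℚ ≤ t′
    0≤t′ = *-cancelʳ-≤-pos p′ {{positive 0<p′}}
      (subst (_≤ t′ * p′) (sym (*-zeroˡ p′)) (≤-trans (<⇒≤ 0<1) 1≤t′p′))

  module _ {ε η h p q s} (2h≡p₀ : h + h ≡ p₀) (0<h : 0ℚ < h) (0<ε : 0ℚ < ε)
    (η≤h : η ≤ h) (η≤εhh : η ≤ ε * (h * h)) (x∈ : Within x p q) (q≤ : q ≤ p + η)
    (0<s : 0ℚ < s) (sq≡1 : s * q ≡ 1ℚ) where
    open ≤-Reasoning
    open +-*-Solver

    h≤p : h ≤ p
    h≤p = begin
      h          ≡⟨ solve 1 (λ h → h := h :+ h :- h) refl h ⟩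
      h + h - h  ≡⟨ cong (_- h) 2h≡p₀ ⟩
      p₀ - h     ≤⟨ +-monoˡ-≤ (- h) (≤-trans (meet x x∈₀ x∈) (≤-trans q≤ (+-monoʳ-≤ p η≤h))) ⟩
      p + h - h  ≡⟨ solve 2 (λ p h → p :+ h :- h := p) refl p h ⟩
      p          ∎

    sh≤1 : s * h ≤ 1ℚ
    sh≤1 = subst (s * h ≤_) sq≡1 (*-monoˡ (<⇒≤ 0<s) (≤-trans h≤p (meet x x∈ x∈)))

    sη≤εp : s * η ≤ ε * p
    sη≤εp = begin
      s * η              ≤⟨ *-monoˡ (<⇒≤ 0<s) η≤εhh ⟩
      s * (ε * (h * h))  ≡⟨ solve 3 (λ s e h → s :* (e :* (h :* h)) := s :* h :* (e :* h)) refl s ε h ⟩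
      s * h * (ε * h)    ≤⟨ *-monoʳ (<⇒≤ (*-pos 0<ε 0<h)) sh≤1 ⟩
      1ℚ * (ε * h)       ≡⟨ *-identityˡ (ε * h) ⟩
      ε * h              ≤⟨ *-monoˡ (<⇒≤ 0<ε) h≤p ⟩
      ε * p              ∎

    1≤[s+ε]p : 1ℚ ≤ (s + ε) * p
    1≤[s+ε]p = begin
      1ℚ             ≡⟨ sq≡1 ⟨
      s * q          ≤⟨ *-monoˡ (<⇒≤ 0<s) q≤ ⟩
      s * (p + η)    ≡⟨ *-distribˡ-+ s p η ⟩
      s * p + s * η  ≤⟨ +-monoʳ-≤ (s * p) sη≤εp ⟩
      s * p + ε * p  ≡⟨ *-distribʳ-+ p s ε ⟨
      (s + ε) * p    ∎

    short-interval : ∃₂ λ s t → W s t × t ≤ s + ε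
    short-interval = s , s + ε , (p , q , x∈ , <-≤-trans 0<h h≤p , ≤-reflexive sq≡1 , 1≤[s+ε]p) , ≤-refl

  W-narrow : ∀ {ε} → 0ℚ < ε → ∃₂ λ s t → W s t × t ≤ s + ε
  W-narrow 0<ε =
    let h , 0<h , 2h≡p₀     = half 0<p₀
        η , 0<η , η≤h , η≤  = shrink 0<h (*-pos 0<ε (*-pos 0<h 0<h))
        p , q , x∈ , q≤     = narrow x 0<η
        s , 0<s , sq≡1      = inverse (<-≤-trans 0<p₀ (meet x x∈₀ x∈))
    in short-interval 2h≡p₀ 0<h 0<ε η≤h η≤ x∈ q≤ 0<s sq≡1

square-cancel : ∀ {s t} → 0ℚ ≤ t → s * s ≤ t * t → s ≤ t
square-cancel {s} {t} 0≤t s²≤t² = ≮⇒≥ λ t<s → <-irrefl refl (<-≤-trans (begin-strict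
  t * t  ≤⟨ *-monoˡ 0≤t (<⇒≤ t<s) ⟩
  t * s  <⟨ *-monoˡ-<-pos s {{positive (≤-<-trans 0≤t t<s)}} t<s ⟩
  s * s  ∎) s²≤t²)
  where open ≤-Reasoning

large-square : ∀ q {δ} → 0ℚ < δ → ∃[ n ] q ≤ ι n * δ * (ι n * δ)
large-square q {δ} 0<δ =
  let K , 1≤K , q≤K = common-bound 1ℚ q
      n , K≤nδ      = archimedean 0<δ K
  in n , bound q≤K 1≤K K≤nδ
  where
  open ≤-Reasoning
  bound : ∀ {K z} → q ≤ K → 1ℚ ≤ K → K ≤ z → q ≤ z * z
  bound {K} {z} q≤K 1≤K K≤z = begin
    q       ≤⟨ ≤-trans q≤K K≤z ⟩
    z       ≡⟨ *-identityˡ z ⟨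
    1ℚ * z  ≤⟨ *-monoʳ (≤-trans (<⇒≤ 0<1) (≤-trans 1≤K K≤z)) (≤-trans 1≤K K≤z) ⟩
    z * z   ∎

-- The square root of max(x, 0): s ≤ √p means s ≤ 0 or s² ≤ p.
√_ : ℝ → ℝ
√ x = record { Within = W ; meet = W-meet ; narrow = W-narrow }
  where
  W : ℚ → ℚ → Set
  W s t = ∃₂ λ p q → Within x p q × (s ≤ 0ℚ ⊎ s * s ≤ p) × 0ℚ ≤ t × q ≤ t * t

  W-meet : ∀ {s t s′ t′} → W s t → W s′ t′ → s ≤ t′
  W-meet (_ , _ , _ , inj₁ s≤0 , _) (_ , _ , _ , _ , 0≤t′ , _) = ≤-trans s≤0 0≤t′
  W-meet (_ , _ , x∈ , inj₂ s²≤p , _) (_ , _ , x∈′ , _ , 0≤t′ , q′≤t′²) =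
    square-cancel 0≤t′ (≤-trans s²≤p (≤-trans (meet x x∈ x∈′) q′≤t′²))

  module _ {ε δ p q} (0<ε : 0ℚ < ε) (0<δ : 0ℚ < δ) (2δ≡ε : δ + δ ≡ ε)
    (x∈ : Within x p q) (q≤ : q ≤ p + δ * δ) where
    open ≤-Reasoning
    open +-*-Solver

    module _ {A} (0≤A : 0ℚ ≤ A) (A²≤q : A * A ≤ q) (q≤[A+δ]² : q ≤ (A + δ) * (A + δ)) where
      lower : (A - δ) ≤ 0ℚ ⊎ (A - δ) * (A - δ) ≤ p
      lower with ≤-total A δ
      ... | inj₁ A≤δ = inj₁ (subst (A - δ ≤_) (+-inverseʳ δ) (+-monoˡ-≤ (- δ) A≤δ))
      ... | inj₂ δ≤A = inj₂ (begin
        (A - δ) * (A - δ)                        ≡⟨ solve 2 (λ a d → (a :- d) :* (a :- d) :=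
                                                     a :* a :+ d :* d :+ (:- (a :* d) :+ :- (a :* d))) refl A δ ⟩
        A * A + δ * δ + (- (A * δ) + - (A * δ))  ≤⟨ +-monoʳ-≤ (A * A + δ * δ) (+-mono-≤ δ²≤Aδ δ²≤Aδ) ⟩
        A * A + δ * δ + (- (δ * δ) + - (δ * δ))  ≡⟨ solve 2 (λ a d → a :+ d :+ (:- d :+ :- d) := a :- d) refl (A * A) (δ * δ) ⟩
        A * A - δ * δ                            ≤⟨ +-monoˡ-≤ (- (δ * δ)) (≤-trans A²≤q q≤) ⟩
        p + δ * δ - δ * δ                        ≡⟨ solve 2 (λ p d → p :+ d :- d := p) refl p (δ * δ) ⟩
        p                                        ∎)
        where
        δ²≤Aδ : - (A * δ) ≤ - (δ * δ)
        δ²≤Aδ = neg-antimono-≤ (*-monoʳ (<⇒≤ 0<δ) δ≤A)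

      short-interval : ∃₂ λ s t → W s t × t ≤ s + ε
      short-interval = A - δ , A + δ ,
        (p , q , x∈ , lower , +-mono-≤ {0ℚ} {A} {0ℚ} {δ} 0≤A (<⇒≤ 0<δ) , q≤[A+δ]²) ,
        ≤-reflexive (trans (solve 2 (λ a d → a :+ d := a :- d :+ (d :+ d)) refl A δ)
                           (cong (λ z → A - δ + z) 2δ≡ε))

    zero-interval : q ≤ 0ℚ → ∃₂ λ s t → W s t × t ≤ s + ε
    zero-interval q≤0 = 0ℚ , 0ℚ , (p , q , x∈ , inj₁ ≤-refl , ≤-refl , q≤0) , p≤p+ε 0ℚ (<⇒≤ 0<ε)

    from-grid : (q ≤ ι 0 * δ * (ι 0 * δ)) ⊎
      (∃[ n ] ¬ q ≤ ι n * δ * (ι n * δ) × q ≤ ι (suc n) * δ * (ι (suc n) * δ)) →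
      ∃₂ λ s t → W s t × t ≤ s + ε
    from-grid (inj₁ h) = zero-interval (subst (λ z → q ≤ z * z) (ι0-* δ) h)
    from-grid (inj₂ (n , q≰ , q≤′)) = short-interval (*-nn (0≤ι n) (<⇒≤ 0<δ))
      (<⇒≤ (≰⇒> q≰)) (subst (λ z → q ≤ z * z) (ι-suc-* n δ) q≤′)

  W-narrow : ∀ {ε} → 0ℚ < ε → ∃₂ λ s t → W s t × t ≤ s + ε
  W-narrow 0<ε =
    let δ , 0<δ , 2δ≡ε  = half 0<ε
        p , q , x∈ , q≤ = narrow x (*-pos 0<δ 0<δ)
        N , hN          = large-square q 0<δ
    in from-grid 0<ε 0<δ 2δ≡ε x∈ q≤
         (search (λ n → q ≤? ι n * δ * (ι n * δ)) N hN)

^-nn : ∀ {x} n → 0ℚ ≤ x → 0ℚ ≤ x ^ n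
^-nn zero    0≤x = <⇒≤ 0<1
^-nn (suc n) 0≤x = *-nn 0≤x (^-nn n 0≤x)

^-pos : ∀ {x} n → 0ℚ < x → 0ℚ < x ^ n
^-pos zero    0<x = 0<1
^-pos (suc n) 0<x = *-pos 0<x (^-pos n 0<x)

^-monoˡ : ∀ {x y} n → 0ℚ ≤ x → x ≤ y → x ^ n ≤ y ^ n
^-monoˡ zero    0≤x x≤y = ≤-refl
^-monoˡ (suc n) 0≤x x≤y = *-mono 0≤x (^-nn n (≤-trans 0≤x x≤y)) x≤y (^-monoˡ n 0≤x x≤y)

1≤^ : ∀ {x} n → 1ℚ ≤ x → 1ℚ ≤ x ^ n
1≤^ zero    1≤x = ≤-refl
1≤^ {x} (suc n) 1≤x = ≤-trans 1≤x (subst (_≤ x * x ^ n) (*-identityʳ x)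
  (*-monoˡ (≤-trans (<⇒≤ 0<1) 1≤x) (1≤^ n 1≤x)))

^≤1 : ∀ {x} n → 0ℚ ≤ x → x ≤ 1ℚ → x ^ n ≤ 1ℚ
^≤1 zero    0≤x x≤1 = ≤-refl
^≤1 {x} (suc n) 0≤x x≤1 = ≤-trans
  (subst (x * x ^ n ≤_) (*-identityʳ x) (*-monoˡ 0≤x (^≤1 n 0≤x x≤1))) x≤1

^-cancel : ∀ {x y} n → 0ℚ ≤ y → x ^ suc n ≤ y ^ suc n → x ≤ y
^-cancel {x} {y} n 0≤y h = ≮⇒≥ λ y<x → <-irrefl refl (<-≤-trans (begin-strict
  y * y ^ n  ≤⟨ *-monoˡ 0≤y (^-monoˡ n 0≤y (<⇒≤ y<x)) ⟩
  y * x ^ n  <⟨ *-monoˡ-<-pos (x ^ n) {{positive (^-pos n (≤-<-trans 0≤y y<x))}} y<x ⟩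
  x * x ^ n  ∎) h)
  where open ≤-Reasoning

bernoulli : ∀ {u} n → 0ℚ ≤ u → 1ℚ + ι n * u ≤ (1ℚ + u) ^ n
bernoulli {u} zero    0≤u = ≤-reflexive (solve 1 (λ u → con 1ℚ :+ con 0ℚ :* u := con 1ℚ) refl u)
  where open +-*-Solver
bernoulli {u} (suc n) 0≤u = begin
  1ℚ + ι (suc n) * u                        ≡⟨ cong (λ z → 1ℚ + z * u) (ι-suc n) ⟩
  1ℚ + (ι n + 1ℚ) * u                       ≤⟨ p≤p+ε (1ℚ + (ι n + 1ℚ) * u) (*-nn 0≤u (*-nn (0≤ι n) 0≤u)) ⟩
  1ℚ + (ι n + 1ℚ) * u + u * (ι n * u)       ≡⟨ solve 2 (λ z u → con 1ℚ :+ (z :+ con 1ℚ) :* u :+ u :* (z :* u)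
                                               := (con 1ℚ :+ u) :* (con 1ℚ :+ z :* u)) refl (ι n) u ⟩
  (1ℚ + u) * (1ℚ + ι n * u)                 ≤⟨ *-monoˡ (≤-trans (<⇒≤ 0<1) (p≤p+ε 1ℚ 0≤u)) (bernoulli n 0≤u) ⟩
  (1ℚ + u) * (1ℚ + u) ^ n                   ∎
  where
  open ≤-Reasoning
  open +-*-Solver

2ℚ : ℚ
2ℚ = ι 2

0<2 : 0ℚ < 2ℚ
0<2 = from-yes (0ℚ <? 2ℚ)

2^ᶻ_ : ℤ → ℚ
2^ᶻ (+ n)    = 2ℚ ^ n
2^ᶻ -[1+ n ] = ½ ^ suc n

2^ᶻ-pos : ∀ i → 0ℚ < 2^ᶻ i
2^ᶻ-pos (+ n)    = ^-pos n 0<2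
2^ᶻ-pos -[1+ n ] = ^-pos (suc n) 0<½

2^ᶻ-suc : ∀ i → 2^ᶻ (ℤ.suc i) ≡ 2ℚ * 2^ᶻ i
2^ᶻ-suc (+ n)          = refl
2^ᶻ-suc -[1+ zero ]    = refl
2^ᶻ-suc -[1+ suc n ]   = trans (sym (*-identityˡ (½ ^ suc n))) (*-assoc 2ℚ ½ (½ ^ suc n))

2^ᶻ-+ : ∀ i n → 2^ᶻ (i ℤ.+ + n) ≡ 2^ᶻ i * 2ℚ ^ n
2^ᶻ-+ i zero    = trans (cong 2^ᶻ_ (ℤ.+-identityʳ i)) (sym (*-identityʳ (2^ᶻ i)))
2^ᶻ-+ i (suc n) = begin
  2^ᶻ (i ℤ.+ + suc n)       ≡⟨ cong 2^ᶻ_ (shift i (+ n)) ⟩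
  2^ᶻ ℤ.suc (i ℤ.+ + n)     ≡⟨ 2^ᶻ-suc (i ℤ.+ + n) ⟩
  2ℚ * 2^ᶻ (i ℤ.+ + n)      ≡⟨ cong (2ℚ *_) (2^ᶻ-+ i n) ⟩
  2ℚ * (2^ᶻ i * 2ℚ ^ n)     ≡⟨ swap 2ℚ (2^ᶻ i) (2ℚ ^ n) ⟩
  2^ᶻ i * (2ℚ * 2ℚ ^ n)     ∎
  where
  open ≡-Reasoning
  shift : ∀ i j → i ℤ.+ (+ 1 ℤ.+ j) ≡ + 1 ℤ.+ (i ℤ.+ j)
  shift i j = trans (sym (ℤ.+-assoc i (+ 1) j))
    (trans (cong (ℤ._+ j) (ℤ.+-comm i (+ 1))) (ℤ.+-assoc (+ 1) i j))
  swap : ∀ a b c → a * (b * c) ≡ b * (a * c)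
  swap = solve 3 (λ a b c → a :* (b :* c) := b :* (a :* c)) refl
    where open +-*-Solver

1≤2^ : ∀ n → 1ℚ ≤ 2ℚ ^ n
1≤2^ n = 1≤^ n (from-yes (1ℚ ≤? 2ℚ))

2^ᶻ-mono : ∀ {i j} → i ℤ.≤ j → 2^ᶻ i ≤ 2^ᶻ j
2^ᶻ-mono {i} {j} i≤j = begin
  2^ᶻ i                  ≡⟨ *-identityʳ (2^ᶻ i) ⟨
  2^ᶻ i * 1ℚ             ≤⟨ *-monoˡ (<⇒≤ (2^ᶻ-pos i)) (1≤2^ n) ⟩
  2^ᶻ i * 2ℚ ^ n         ≡⟨ 2^ᶻ-+ i n ⟨
  2^ᶻ (i ℤ.+ + n)        ≡⟨ cong 2^ᶻ_ i+n≡j ⟩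
  2^ᶻ j                  ∎
  where
  open ≤-Reasoning
  n = ℤ.∣ j ℤ.- i ∣
  i+n≡j : i ℤ.+ + n ≡ j
  i+n≡j = trans (cong (λ k → i ℤ.+ k) (ℤ.0≤i⇒+∣i∣≡i (ℤ.i≤j⇒0≤j-i i≤j)))
    (trans (ℤ.+-comm i (j ℤ.- i)) (trans (ℤ.+-assoc j (ℤ.- i) i)
    (trans (cong (λ k → j ℤ.+ k) (ℤ.+-inverseˡ i)) (ℤ.+-identityʳ j))))

2^ᶻ-^ : ∀ i n → (2^ᶻ i) ^ n ≡ 2^ᶻ (i ℤ.* + n)
2^ᶻ-^ (+ m) n = trans (^-assocʳ 2ℚ m n) (cong 2^ᶻ_ (ℤ.pos-* m n))
2^ᶻ-^ -[1+ m ] n = trans (^-assocʳ ½ (suc m) n) (trans (½^ (suc m ℕ.* n))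
  (cong 2^ᶻ_ (trans (cong ℤ.-_ (ℤ.pos-* (suc m) n)) (ℤ.neg-distribˡ-* (+ suc m) (+ n)))))
  where
  ½^ : ∀ k → ½ ^ k ≡ 2^ᶻ (ℤ.- + k)
  ½^ zero    = refl
  ½^ (suc k) = refl

-- If x ≤ 2^(i/(a+1)), i/(a+1) ≤ j/(b+1) and 2^(j/(b+1)) ≤ y then x ≤ y.
root-mono : ∀ {x y i j a b} → 0ℚ ≤ x → 0ℚ ≤ y → x ^ suc a ≤ 2^ᶻ i → 2^ᶻ j ≤ y ^ suc b →
            i ℤ.* + suc b ℤ.≤ j ℤ.* + suc a → x ≤ y
root-mono {x} {y} {i} {j} {a} {b} 0≤x 0≤y hx hy h = ^-cancel (b ℕ.+ a ℕ.* suc b) 0≤y (begin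
  x ^ (suc a ℕ.* suc b)    ≡⟨ ^-assocʳ x (suc a) (suc b) ⟨
  (x ^ suc a) ^ suc b      ≤⟨ ^-monoˡ (suc b) (^-nn (suc a) 0≤x) hx ⟩
  (2^ᶻ i) ^ suc b          ≡⟨ 2^ᶻ-^ i (suc b) ⟩
  2^ᶻ (i ℤ.* + suc b)      ≤⟨ 2^ᶻ-mono h ⟩
  2^ᶻ (j ℤ.* + suc a)      ≡⟨ 2^ᶻ-^ j (suc a) ⟨
  (2^ᶻ j) ^ suc a          ≤⟨ ^-monoˡ (suc a) (<⇒≤ (2^ᶻ-pos j)) hy ⟩
  (y ^ suc b) ^ suc a      ≡⟨ ^-assocʳ y (suc b) (suc a) ⟩
  y ^ (suc b ℕ.* suc a)    ≡⟨ cong (y ^_) (ℕ.*-comm (suc b) (suc a)) ⟩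
  y ^ (suc a ℕ.* suc b)    ∎)
  where open ≤-Reasoning

-- If A ≤ 2^(j/b), c ≤ 2^(- 1/n) and j/b ≤ i/a + 1/n then A c ≤ 2^(i/a).
root-shrink : ∀ {A c i j a} b′ n′ → let b = suc b′ ; n = suc n′ in
  0ℚ ≤ A → 0ℚ ≤ c → A ^ b ≤ 2^ᶻ j → 2ℚ * c ^ n ≤ 1ℚ →
  j ℤ.* + (a ℕ.* n) ℤ.≤ i ℤ.* + (b ℕ.* n) ℤ.+ + (a ℕ.* b) →
  (A * c) ^ a ≤ 2^ᶻ i
root-shrink {A} {c} {i} {j} {a} b′ n′ 0≤A 0≤c hA hc h =
  ^-cancel (n′ ℕ.+ b′ ℕ.* suc n′) (<⇒≤ (2^ᶻ-pos i))
    (*-cancelˡ-≤-pos (2ℚ ^ (a ℕ.* b)) {{positive (^-pos (a ℕ.* b) 0<2)}} (begin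
      2ℚ ^ (a ℕ.* b) * ((A * c) ^ a) ^ (b ℕ.* n)                   ≡⟨ cong (2ℚ ^ (a ℕ.* b) *_) split ⟩
      2ℚ ^ (a ℕ.* b) * ((A ^ b) ^ (a ℕ.* n) * (c ^ n) ^ (a ℕ.* b)) ≡⟨ swap (2ℚ ^ (a ℕ.* b)) ((A ^ b) ^ (a ℕ.* n)) ((c ^ n) ^ (a ℕ.* b)) ⟩
      (A ^ b) ^ (a ℕ.* n) * (2ℚ ^ (a ℕ.* b) * (c ^ n) ^ (a ℕ.* b)) ≡⟨ cong ((A ^ b) ^ (a ℕ.* n) *_) (^-distrib-* 2ℚ (c ^ n) (a ℕ.* b)) ⟨
      (A ^ b) ^ (a ℕ.* n) * (2ℚ * c ^ n) ^ (a ℕ.* b)               ≤⟨ *-monoˡ (^-nn (a ℕ.* n) (^-nn b 0≤A)) (^≤1 (a ℕ.* b) (*-nn (<⇒≤ 0<2) (^-nn n 0≤c)) hc) ⟩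
      (A ^ b) ^ (a ℕ.* n) * 1ℚ                                     ≡⟨ *-identityʳ ((A ^ b) ^ (a ℕ.* n)) ⟩
      (A ^ b) ^ (a ℕ.* n)                                          ≤⟨ ^-monoˡ (a ℕ.* n) (^-nn b 0≤A) hA ⟩
      (2^ᶻ j) ^ (a ℕ.* n)                                          ≡⟨ 2^ᶻ-^ j (a ℕ.* n) ⟩
      2^ᶻ (j ℤ.* + (a ℕ.* n))                                      ≤⟨ 2^ᶻ-mono h ⟩
      2^ᶻ (i ℤ.* + (b ℕ.* n) ℤ.+ + (a ℕ.* b))                      ≡⟨ 2^ᶻ-+ (i ℤ.* + (b ℕ.* n)) (a ℕ.* b) ⟩
      2^ᶻ (i ℤ.* + (b ℕ.* n)) * 2ℚ ^ (a ℕ.* b)                     ≡⟨ *-comm (2^ᶻ (i ℤ.* + (b ℕ.* n))) (2ℚ ^ (a ℕ.* b)) ⟩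
      2ℚ ^ (a ℕ.* b) * 2^ᶻ (i ℤ.* + (b ℕ.* n))                     ≡⟨ cong (2ℚ ^ (a ℕ.* b) *_) (2^ᶻ-^ i (b ℕ.* n)) ⟨
      2ℚ ^ (a ℕ.* b) * (2^ᶻ i) ^ (b ℕ.* n)                         ∎))
  where
  open ≤-Reasoning
  b n : ℕ
  b = suc b′
  n = suc n′
  swap : ∀ x y z → x * (y * z) ≡ y * (x * z)
  swap = solve 3 (λ a b c → a :* (b :* c) := b :* (a :* c)) refl
    where open +-*-Solver
  ℕ-swap : ∀ x y z → x ℕ.* (y ℕ.* z) ≡ y ℕ.* (x ℕ.* z)
  ℕ-swap x y z = trans (sym (ℕ.*-assoc x y z)) (trans (cong (ℕ._* z) (ℕ.*-comm x y)) (ℕ.*-assoc y x z))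
  split : ((A * c) ^ a) ^ (b ℕ.* n) ≡ (A ^ b) ^ (a ℕ.* n) * (c ^ n) ^ (a ℕ.* b)
  split = begin-equality
    ((A * c) ^ a) ^ (b ℕ.* n)                        ≡⟨ ^-assocʳ (A * c) a (b ℕ.* n) ⟩
    (A * c) ^ (a ℕ.* (b ℕ.* n))                      ≡⟨ ^-distrib-* A c (a ℕ.* (b ℕ.* n)) ⟩
    A ^ (a ℕ.* (b ℕ.* n)) * c ^ (a ℕ.* (b ℕ.* n))    ≡⟨ cong₂ (λ k l → A ^ k * c ^ l) (ℕ-swap a b n)
                                                         (trans (sym (ℕ.*-assoc a b n)) (ℕ.*-comm (a ℕ.* b) n)) ⟩
    A ^ (b ℕ.* (a ℕ.* n)) * c ^ (n ℕ.* (a ℕ.* b))    ≡⟨ cong₂ _*_ (^-assocʳ A b (a ℕ.* n)) (^-assocʳ c n (a ℕ.* b)) ⟨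
    (A ^ b) ^ (a ℕ.* n) * (c ^ n) ^ (a ℕ.* b)        ∎

numerators : ∀ p q n → q ≤ p + 1/1+ n →
  ↥ q ℤ.* + (↧ₙ p ℕ.* suc n) ℤ.≤ ↥ p ℤ.* + (↧ₙ q ℕ.* suc n) ℤ.+ + (↧ₙ p ℕ.* ↧ₙ q)
numerators p q n q≤ = ιℤ-cancel (begin
  ιℤ (↥ q ℤ.* + (a ℕ.* suc n))                                ≡⟨ product q a ⟩
  q * ι b * (ι a * N)                                         ≡⟨ solve 4 (λ q a b n → q :* b :* (a :* n) := q :* (a :* b :* n)) refl q (ι a) (ι b) N ⟩
  q * (ι a * ι b * N)                                         ≤⟨ *-monoʳ (*-nn (*-nn (0≤ι a) (0≤ι b)) (0≤ι (suc n))) q≤ ⟩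
  (p + u) * (ι a * ι b * N)                                   ≡⟨ solve 5 (λ p u a b n → (p :+ u) :* (a :* b :* n) :=
                                                                 p :* a :* (b :* n) :+ u :* n :* (a :* b)) refl p u (ι a) (ι b) N ⟩
  p * ι a * (ι b * N) + u * N * (ι a * ι b)                   ≡⟨ cong₂ _+_ (sym (product p b)) (cong (_* (ι a * ι b)) (1/1+-inverse n)) ⟩
  ιℤ (↥ p ℤ.* + (b ℕ.* suc n)) + 1ℚ * (ι a * ι b)             ≡⟨ cong (λ z → ιℤ (↥ p ℤ.* + (b ℕ.* suc n)) + z)
                                                                 (trans (*-identityˡ (ι a * ι b)) (sym (ι-* a b))) ⟩
  ιℤ (↥ p ℤ.* + (b ℕ.* suc n)) + ι (a ℕ.* b)                  ≡⟨ ιℤ-+ (↥ p ℤ.* + (b ℕ.* suc n)) (+ (a ℕ.* b)) ⟨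
  ιℤ (↥ p ℤ.* + (b ℕ.* suc n) ℤ.+ + (a ℕ.* b))                ∎)
  where
  open ≤-Reasoning
  open +-*-Solver
  a b : ℕ
  a = ↧ₙ p
  b = ↧ₙ q
  u N : ℚ
  u = 1/1+ n
  N = ι (suc n)
  ι-* : ∀ k l → ι (k ℕ.* l) ≡ ι k * ι l
  ι-* k l = trans (cong ιℤ (ℤ.pos-* k l)) (ιℤ-* (+ k) (+ l))
  product : ∀ r c → ιℤ (↥ r ℤ.* + (c ℕ.* suc n)) ≡ r * ι (↧ₙ r) * (ι c * N)
  product r c = trans (ιℤ-* (↥ r) (+ (c ℕ.* suc n))) (cong₂ _*_ (ιℤ-↥ r) (ι-* c (suc n)))

-- For rational p with numerator m and denominator d, s ≤ 2^p means s^d ≤ 2^m.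
2^ᴿ_ : ℝ → ℝ
2^ᴿ x = record
  { Within = W
  ; meet   = λ {s} {t} {s′} {t′} → W-meet {s} {t} {s′} {t′}
  ; narrow = W-narrow
  }
  where
  W : ℚ → ℚ → Set
  W s t = 0ℚ ≤ s × 0ℚ ≤ t × (∃₂ λ p q → Within x p q ×
          s ^ ↧ₙ p ≤ 2^ᶻ (↥ p) × 2^ᶻ (↥ q) ≤ t ^ ↧ₙ q)

  W-meet : ∀ {s t s′ t′} → W s t → W s′ t′ → s ≤ t′
  W-meet {s} {t′ = t′} (0≤s , _ , p , _ , x∈ , hs , _) (_ , 0≤t′ , _ , q , x∈′ , _ , ht′) =
    root-mono {s} {t′} {↥ p} {↥ q} 0≤s 0≤t′ hs ht′ (drop-*≤* (meet x x∈ x∈′))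

  module _ {ε δ p q M} {n : ℕ} (2δ≡ε : δ + δ ≡ ε) (0<δ : 0ℚ < δ) (q≤M : q ≤ ι M)
    (2^M≤ : 2ℚ ^ M ≤ ι n * δ) (x∈ : Within x p q) (q≤ : q ≤ p + 1/1+ n) where
    open ≤-Reasoning
    open +-*-Solver

    u : ℚ
    u = 1/1+ n

    0≤u : 0ℚ ≤ u
    0≤u = <⇒≤ (0<1/1+ n)

    2^Mu≤δ : 2ℚ ^ M * u ≤ δ
    2^Mu≤δ = begin
      2ℚ ^ M * u           ≤⟨ *-monoʳ 0≤u (≤-trans 2^M≤ (*-monoʳ (<⇒≤ 0<δ) (ι-mono (ℕ.n≤1+n n)))) ⟩
      ι (suc n) * δ * u    ≡⟨ solve 3 (λ n d u → n :* d :* u := u :* n :* d) refl (ι (suc n)) δ u ⟩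
      u * ι (suc n) * δ    ≡⟨ cong (_* δ) (1/1+-inverse n) ⟩
      1ℚ * δ               ≡⟨ *-identityˡ δ ⟩
      δ                    ∎

    module _ {c} (0<c : 0ℚ < c) (c[1+u]≡1 : c * (1ℚ + u) ≡ 1ℚ)
      {A} (0≤A : 0ℚ ≤ A) (A^d≤2^m : A ^ ↧ₙ q ≤ 2^ᶻ (↥ q)) (2^m≤ : 2^ᶻ (↥ q) ≤ (A + δ) ^ ↧ₙ q) where

      0≤c : 0ℚ ≤ c
      0≤c = <⇒≤ 0<c

      c≤1 : c ≤ 1ℚ
      c≤1 = begin
        c              ≡⟨ *-identityʳ c ⟨
        c * 1ℚ         ≤⟨ *-monoˡ 0≤c (p≤p+ε 1ℚ 0≤u) ⟩
        c * (1ℚ + u)   ≡⟨ c[1+u]≡1 ⟩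
        1ℚ             ∎

      2≤[1+u]^ : 2ℚ ≤ (1ℚ + u) ^ suc n
      2≤[1+u]^ = begin
        2ℚ                       ≡⟨⟩
        1ℚ + 1ℚ                  ≡⟨ cong (λ z → 1ℚ + z) (trans (*-comm (ι (suc n)) u) (1/1+-inverse n)) ⟨
        1ℚ + ι (suc n) * u       ≤⟨ bernoulli (suc n) 0≤u ⟩
        (1ℚ + u) ^ suc n         ∎

      1^ : ∀ k → 1ℚ ^ k ≡ 1ℚ
      1^ zero    = refl
      1^ (suc k) = trans (*-identityˡ (1ℚ ^ k)) (1^ k)

      2c^≤1 : 2ℚ * c ^ suc n ≤ 1ℚ
      2c^≤1 = begin
        2ℚ * c ^ suc n                   ≤⟨ *-monoʳ (^-nn (suc n) 0≤c) 2≤[1+u]^ ⟩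
        (1ℚ + u) ^ suc n * c ^ suc n     ≡⟨ *-comm ((1ℚ + u) ^ suc n) (c ^ suc n) ⟩
        c ^ suc n * (1ℚ + u) ^ suc n     ≡⟨ ^-distrib-* c (1ℚ + u) (suc n) ⟨
        (c * (1ℚ + u)) ^ suc n           ≡⟨ cong (_^ suc n) c[1+u]≡1 ⟩
        1ℚ ^ suc n                       ≡⟨ 1^ (suc n) ⟩
        1ℚ                               ∎

      A≤2^M : A ≤ 2ℚ ^ M
      A≤2^M = ^-cancel (ℚ.denominator-1 q) (^-nn M (<⇒≤ 0<2)) (begin
        A ^ ↧ₙ q              ≤⟨ A^d≤2^m ⟩
        2^ᶻ (↥ q)             ≤⟨ 2^ᶻ-mono ↥q≤ ⟩
        2^ᶻ (+ M ℤ.* ↧ q)     ≡⟨ 2^ᶻ-^ (+ M) (↧ₙ q) ⟨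
        (2ℚ ^ M) ^ ↧ₙ q       ∎)
        where
        ↥q≤ : ↥ q ℤ.≤ + M ℤ.* ↧ q
        ↥q≤ = subst (ℤ._≤ + M ℤ.* ↧ q) (ℤ.*-identityʳ (↥ q)) (drop-*≤* q≤M)

      Acu≤δ : A * c * u ≤ δ
      Acu≤δ = begin
        A * c * u    ≤⟨ *-monoʳ 0≤u (subst (A * c ≤_) (*-identityʳ A) (*-monoˡ 0≤A c≤1)) ⟩
        A * u        ≤⟨ *-monoʳ 0≤u A≤2^M ⟩
        2ℚ ^ M * u   ≤⟨ 2^Mu≤δ ⟩
        δ            ∎

      short : A + δ ≤ A * c + ε
      short = begin
        A + δ                    ≡⟨ cong (_+ δ) (*-identityʳ A) ⟨
        A * 1ℚ + δ               ≡⟨ cong (λ z → A * z + δ) c[1+u]≡1 ⟨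
        A * (c * (1ℚ + u)) + δ   ≡⟨ solve 4 (λ a c u d → a :* (c :* (con 1ℚ :+ u)) :+ d := a :* c :+ (a :* c :* u :+ d)) refl A c u δ ⟩
        A * c + (A * c * u + δ)  ≤⟨ +-monoʳ-≤ (A * c) (+-monoˡ-≤ δ Acu≤δ) ⟩
        A * c + (δ + δ)          ≡⟨ cong (λ z → A * c + z) 2δ≡ε ⟩
        A * c + ε                ∎

      short-interval : ∃₂ λ s t → W s t × t ≤ s + ε
      short-interval = A * c , A + δ ,
        (*-nn 0≤A 0≤c , +-mono-≤ {0ℚ} {A} {0ℚ} {δ} 0≤A (<⇒≤ 0<δ) , p , q , x∈ ,
          root-shrink {A} {c} {↥ p} {↥ q} {↧ₙ p} (ℚ.denominator-1 q) n 0≤A 0≤c A^d≤2^m 2c^≤1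
            (numerators p q n q≤) ,
          2^m≤) ,
        short

    zero-interval : 2^ᶻ (↥ q) ≤ 0ℚ ^ ↧ₙ q → ∃₂ λ s t → W s t × t ≤ s + ε
    zero-interval h = 0ℚ , 0ℚ ,
      (≤-refl , ≤-refl , p , q , x∈ ,
        subst (_≤ 2^ᶻ (↥ p)) (sym (*-zeroˡ (0ℚ ^ ℚ.denominator-1 p))) (<⇒≤ (2^ᶻ-pos (↥ p))) , h) ,
      p≤p+ε 0ℚ (subst (0ℚ ≤_) 2δ≡ε (+-mono-≤ {0ℚ} {δ} {0ℚ} {δ} (<⇒≤ 0<δ) (<⇒≤ 0<δ)))

    from-grid : (∃[ c ] 0ℚ < c × c * (1ℚ + u) ≡ 1ℚ) → (2^ᶻ (↥ q) ≤ (ι 0 * δ) ^ ↧ₙ q) ⊎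
      (∃[ k ] ¬ 2^ᶻ (↥ q) ≤ (ι k * δ) ^ ↧ₙ q × 2^ᶻ (↥ q) ≤ (ι (suc k) * δ) ^ ↧ₙ q) →
      ∃₂ λ s t → W s t × t ≤ s + ε
    from-grid _ (inj₁ h) = zero-interval (subst (λ z → 2^ᶻ (↥ q) ≤ z ^ ↧ₙ q) (ι0-* δ) h)
    from-grid (c , 0<c , c≡) (inj₂ (k , ≰ , h)) = short-interval 0<c c≡ (*-nn (0≤ι k) (<⇒≤ 0<δ))
      (<⇒≤ (≰⇒> ≰)) (subst (λ z → 2^ᶻ (↥ q) ≤ z ^ ↧ₙ q) (ι-suc-* k δ) h)

    grid-bound : 2^ᶻ (↥ q) ≤ (ι n * δ) ^ ↧ₙ q
    grid-bound = begin
      2^ᶻ (↥ q)             ≤⟨ 2^ᶻ-mono (subst (ℤ._≤ + M ℤ.* ↧ q) (ℤ.*-identityʳ (↥ q)) (drop-*≤* q≤M)) ⟩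
      2^ᶻ (+ M ℤ.* ↧ q)     ≡⟨ 2^ᶻ-^ (+ M) (↧ₙ q) ⟨
      (2ℚ ^ M) ^ ↧ₙ q       ≤⟨ ^-monoˡ (↧ₙ q) (^-nn M (<⇒≤ 0<2)) 2^M≤ ⟩
      (ι n * δ) ^ ↧ₙ q      ∎

    conclude : ∃₂ λ s t → W s t × t ≤ s + ε
    conclude = from-grid (inverse (<-≤-trans 0<1 (p≤p+ε 1ℚ 0≤u)))
      (search (λ k → 2^ᶻ (↥ q) ≤? (ι k * δ) ^ ↧ₙ q) n grid-bound)

  1/1+≤1 : ∀ n → 1/1+ n ≤ 1ℚ
  1/1+≤1 n = 1/1+-anti {0} {n} z≤n

  W-narrow : ∀ {ε} → 0ℚ < ε → ∃₂ λ s t → W s t × t ≤ s + ε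
  W-narrow 0<ε =
    let δ , 0<δ , 2δ≡ε     = half 0<ε
        p₀ , q₀ , x∈₀ , _  = narrow x 0<1
        M , q₀+1≤M         = ι-unbounded (q₀ + 1ℚ)
        n , 2^M≤           = archimedean 0<δ (2ℚ ^ M)
        p , q , x∈ , q≤    = narrow x (0<1/1+ n)
        q≤q₀+1 = ≤-trans q≤ (≤-trans (+-monoʳ-≤ p (1/1+≤1 n)) (+-monoˡ-≤ 1ℚ (meet x x∈ x∈₀)))
    in conclude 2δ≡ε 0<δ (≤-trans q≤q₀+1 q₀+1≤M) 2^M≤ x∈ q≤

inv! : ℕ → ℚ
inv! zero    = 1ℚ
inv! (suc n) = inv! n * 1/1+ n

0<inv! : ∀ n → 0ℚ < inv! n
0<inv! zero    = 0<1
0<inv! (suc n) = *-pos (0<inv! n) (0<1/1+ n)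

inv!-halve : ∀ n → inv! (suc (suc n)) + inv! (suc (suc n)) ≤ inv! (suc n)
inv!-halve n = begin
  x * 1/1+ suc n + x * 1/1+ suc n   ≡⟨ *-distribˡ-+ x (1/1+ suc n) (1/1+ suc n) ⟨
  x * (1/1+ suc n + 1/1+ suc n)     ≤⟨ *-monoˡ (<⇒≤ (0<inv! (suc n))) (+-mono-≤ {1/1+ suc n} {½} {1/1+ suc n} {½} ≤½ ≤½) ⟩
  x * (½ + ½)                       ≡⟨ *-identityʳ x ⟩
  x                                 ∎
  where
  open ≤-Reasoning
  x = inv! (suc n)
  ≤½ : 1/1+ suc n ≤ ½
  ≤½ = 1/1+-anti {1} {suc n} (s≤s z≤n)

inv!≤ : ∀ n → inv! (suc n) ≤ 1/1+ n
inv!≤ n = subst (inv! (suc n) ≤_) (*-identityˡ (1/1+ n)) (*-monoʳ (<⇒≤ (0<1/1+ n)) (≤1 n))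
  where
  ≤1 : ∀ n → inv! n ≤ 1ℚ
  ≤1 zero    = ≤-refl
  ≤1 (suc n) = ≤-trans (inv!≤ n) (1/1+-anti {0} {n} z≤n)

e-sum : ℕ → ℚ
e-sum zero    = 0ℚ
e-sum (suc n) = e-sum n + inv! n

-- e = Σ 1/i!.  With S the partial sum up to 1/(n+1)!, the tail beyond S is
-- at most 1/(n+1)!, so e lies in [S , S + 1/(n+1)!].
e : ℝ
e = nested lo hi lo↑ hi↓ lo≤hi gap
  where
  open ≤-Reasoning
  lo hi : ℕ → ℚ
  lo n = e-sum (suc (suc n))
  hi n = lo n + inv! (suc n)
  lo↑ : ∀ n → lo n ≤ lo (suc n)
  lo↑ n = p≤p+ε (lo n) (<⇒≤ (0<inv! (suc (suc n))))
  hi↓ : ∀ n → hi (suc n) ≤ hi n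
  hi↓ n = begin
    lo n + y + y    ≡⟨ +-assoc (lo n) y y ⟩
    lo n + (y + y)  ≤⟨ +-monoʳ-≤ (lo n) (inv!-halve n) ⟩
    hi n            ∎
    where y = inv! (suc (suc n))
  lo≤hi : ∀ n → lo n ≤ hi n
  lo≤hi n = p≤p+ε (lo n) (<⇒≤ (0<inv! (suc n)))
  gap : ∀ {ε} → 0ℚ < ε → ∃[ n ] hi n ≤ lo n + ε
  gap {ε} 0<ε = let n , h = 1/1+→0 1 0<ε in
    n , +-monoʳ-≤ (lo n) (≤-trans (inv!≤ n) (subst (_≤ ε) (*-identityˡ (1/1+ n)) h))

leibniz⁺ leibniz⁻ leibniz-sum : ℕ → ℚ
leibniz⁺ n = ι 4 * 1/1+ (4 ℕ.* n)
leibniz⁻ n = ι 4 * 1/1+ (2 ℕ.+ 4 ℕ.* n)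
leibniz-sum zero    = 0ℚ
leibniz-sum (suc n) = leibniz-sum n + (leibniz⁺ n - leibniz⁻ n)

-- π = 4/1 - 4/3 + 4/5 - 4/7 + ⋯ : an alternating series with decreasing
-- terms lies between any two consecutive partial sums.
π : ℝ
π = nested lo hi lo↑ hi↓ lo≤hi gap
  where
  open ≤-Reasoning
  open +-*-Solver
  lo hi : ℕ → ℚ
  lo n = leibniz-sum n
  hi n = leibniz-sum n + leibniz⁺ n
  ⁻≤⁺ : ∀ n → leibniz⁻ n ≤ leibniz⁺ n
  ⁻≤⁺ n = *-monoˡ (0≤ι 4) (1/1+-anti (ℕ.m≤n+m (4 ℕ.* n) 2))
  ⁺≤⁻ : ∀ n → leibniz⁺ (suc n) ≤ leibniz⁻ n
  ⁺≤⁻ n = *-monoˡ (0≤ι 4) (1/1+-anti (subst (2 ℕ.+ 4 ℕ.* n ℕ.≤_) (sym (ℕ.*-suc 4 n))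
    (ℕ.+-monoˡ-≤ (4 ℕ.* n) {2} {4} (s≤s (s≤s z≤n)))))
  lo↑ : ∀ n → lo n ≤ lo (suc n)
  lo↑ n = p≤p+ε (lo n) (subst (_≤ leibniz⁺ n - leibniz⁻ n) (+-inverseʳ (leibniz⁻ n))
    (+-monoˡ-≤ (- leibniz⁻ n) (⁻≤⁺ n)))
  hi↓ : ∀ n → hi (suc n) ≤ hi n
  hi↓ n = begin
    lo n + (leibniz⁺ n - leibniz⁻ n) + leibniz⁺ (suc n)  ≤⟨ +-monoʳ-≤ (lo n + (leibniz⁺ n - leibniz⁻ n)) (⁺≤⁻ n) ⟩
    lo n + (leibniz⁺ n - leibniz⁻ n) + leibniz⁻ n        ≡⟨ solve 3 (λ l a b → l :+ (a :- b) :+ b := l :+ a) refl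
                                                            (lo n) (leibniz⁺ n) (leibniz⁻ n) ⟩
    lo n + leibniz⁺ n                                    ∎
  lo≤hi : ∀ n → lo n ≤ hi n
  lo≤hi n = p≤p+ε (lo n) (*-nn (0≤ι 4) (<⇒≤ (0<1/1+ (4 ℕ.* n))))
  gap : ∀ {ε} → 0ℚ < ε → ∃[ n ] hi n ≤ lo n + ε
  gap 0<ε = let n , h = 1/1+→0 4 0<ε in
    n , +-monoʳ-≤ (lo n) (≤-trans (*-monoˡ (0≤ι 4) (1/1+-anti (ℕ.m≤n*m n 4))) h)

*ᴿ-positive : ∀ x y → Positiveᴿ x → Positiveᴿ y → Positiveᴿ (x *ᴿ y)
*ᴿ-positive x y (p , q , x∈ , 0<p) (r , u , y∈ , 0<r) =
  p * r , q * u , (p , q , r , u , x∈ , y∈ , bnd) , *-pos 0<p 0<r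
  where
  bnd : ∀ {a b} → p ≤ a → a ≤ q → r ≤ b → b ≤ u → p * r ≤ a * b × a * b ≤ q * u
  bnd p≤a a≤q r≤b b≤u =
    *-mono (<⇒≤ 0<p) (≤-trans (<⇒≤ 0<r) r≤b) p≤a r≤b ,
    *-mono (≤-trans (<⇒≤ 0<p) p≤a) (≤-trans (<⇒≤ 0<r) (≤-trans r≤b b≤u)) a≤q b≤u

√-positive : ∀ x → Positiveᴿ x → Positiveᴿ (√ x)
√-positive x (p , q , x∈ , 0<p) =
  let s , 0<s , s≤p , s≤1 = shrink 0<p 0<1
      n , q≤n²            = large-square q 0<1
  in s , ι n * 1ℚ , (p , q , x∈ ,
       inj₂ (≤-trans (*-monoˡ (<⇒≤ 0<s) s≤1) (subst (_≤ p) (sym (*-identityʳ s)) s≤p)) ,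
       *-nn (0≤ι n) (<⇒≤ 0<1) , q≤n²) , 0<s

2π-positive : Positiveᴿ (fromℕ 2 *ᴿ π)
2π-positive = *ᴿ-positive (fromℕ 2) π (ι 2 , ι 2 , (refl , refl) , 0<2)
  (leibniz-sum 1 , leibniz-sum 1 + leibniz⁺ 1 , (1 , refl , refl) , from-yes (0ℚ <? leibniz-sum 1))

e/√2π : ℝ
e/√2π = e *ᴿ recip (√ (fromℕ 2 *ᴿ π)) (√-positive (fromℕ 2 *ᴿ π) 2π-positive)

B : ℝ
B = e/√2π *ᴿ e/√2π *ᴿ e/√2π

-- TOW b₁ (b₂ ∷ … ∷ b_L ∷ []) is TOW(b₁, …, b_L).
TOW : ℝ → List ℝ → ℝ
TOW b []       = 2^ᴿ b
TOW b (c ∷ cs) = 2^ᴿ (b *ᴿ TOW c cs)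

-- The a-element subsets of [n], where Fin n plays the role of [n].
Binom : ℕ → ℕ → Set
Binom n a = Σ[ A ∈ Subset n ] ∣ A ∣ ≡ a

Homogeneous : ∀ {n a} → (Binom n a → Bool) → Subset n → Set
Homogeneous {n} {a} COL H =
  ∀ (A A′ : Binom n a) → proj₁ A ⊆ H → proj₁ A′ ⊆ H → COL A ≡ COL A′

Arrows : ℕ → ℕ → ℕ → Set
Arrows n a k = (COL : Binom n a → Bool) → ∃[ H ] ∣ H ∣ ≡ k × Homogeneous COL H

-- IsR a k n means R(a,k) = n.
IsR : ℕ → ℕ → ℕ → Set
IsR a k n = Arrows n a k × (∀ m → Arrows m a k → n ℕ.≤ m)

infix 4 R[_,_]≤_

-- R(a,k) ≤ x.  The n with IsR a k n is unique, and its existence, Ramsey's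
-- theorem, is part of the claim.
R[_,_]≤_ : ℕ → ℕ → ℝ → Set
R[ a , k ]≤ x = ∃[ n ] IsR a k n × fromℕ n ≤ᴿ x

{-# OPTIONS --safe #-}

-- Colorings of sets are treated as colorings of sublists of a list, so that no
-- symmetry is needed.
-- Triples (Conlon, Fox and Sudakov): pick vertices one at a time and sort each
-- new one into a binary tree by the colors of its pairs with the nodes on its
-- path; exposing a pair keeps the half of the remaining vertices that form
-- triples of one color with it.  A path with n turns to the same side gives a
-- homogeneous set of size n + 1.  Before that the tree has at most
-- C(2n,n) - 1 nodes at depth less than 2n, so 2^((2n+1)(C(2n,n)-1)) vertices
-- suffice, and C(2n,n)² (2n+1) ≤ 16^n bounds the exponent by ½ √n 4^(n+1).
-- Since e ≥ 5/2 and π ≤ 4, ½ ≤ B.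
-- Larger a (Erdős and Rado): R(a+1,k+1) ≤ 2^(R(a,k)^a) for a ≥ 2.
module Submission where

open import Defs
open import Data.Bool.Base using (Bool; true; false)
open import Data.Bool.Properties using () renaming (_≟_ to _≟ᵇ_)
open import Data.Fin.Base using (Fin; zero; suc)
open import Data.Fin.Subset as Subset using (Subset; inside; outside; ⁅_⁆; ∣_∣; ⋃)
open import Data.Fin.Subset.Properties using (∪-identityˡ; anySubset?; _⊆?_; drop-∷-⊆)
import Data.Integer.Base as ℤ
import Data.Integer.Properties as ℤ
open import Data.List.Base
  using (List; []; _∷_; _++_; applyDownFrom; map; length; reverse; _ʳ++_; tabulate)
open import Data.List.Membership.Propositional using (_∈_)
open import Data.List.Membership.Propositional.Properties using (∈-map⁺; ∈-++⁺ˡ; ∈-++⁺ʳ)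
open import Data.List.Properties
  using (length-map; length-++; length-reverse; length-tabulate; reverse-involutive)
open import Data.List.Relation.Binary.Sublist.Propositional
  using (_⊆_; []; _∷_; _∷ʳ_; ⊆-refl; ⊆-trans; minimum; lookup; to∈)
open import Data.List.Relation.Binary.Sublist.Propositional.Properties
  using (ʳ++⁺; reverse⁺; All-resp-⊆)
open import Data.List.Relation.Unary.All as All using (All; []; _∷_)
open import Data.List.Relation.Unary.Any using (here; there)
open import Data.Nat.Base
  using (ℕ; zero; suc; _+_; _*_; _∸_; _^_; _!; _≤_; z≤n; s≤s; s≤s⁻¹; >-nonZero)
open import Data.Nat.Properties
open import Data.Nat.Solver using (module +-*-Solver)
open import Data.Product.Base using (_×_; ∃₂; ∃-syntax; _,_; proj₁; proj₂)
open import Data.Rational.Base as ℚ using (ℚ; 0ℚ; 1ℚ; ½; ↥_; ↧_; ↧ₙ_; positive)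
import Data.Rational.Properties as ℚ
import Data.Rational.Solver as ℚ
open import Data.Sum.Base using (_⊎_; inj₁; inj₂)
open import Data.Vec.Base using ([]; _∷_; here)
open import Function.Base using (_∘_)
open import Algebra.Definitions.RawSemiring ℚ.+-*-rawSemiring using () renaming (_^_ to _^ℚ_)
open import Relation.Binary.PropositionalEquality
open import Relation.Nullary.Decidable
  using (Dec; yes; no; map′; _×-dec_; _→-dec_; ¬?; decidable-stable; from-yes)
open import Relation.Nullary.Negation using (contradiction)

private variable
  V : Set

-- Ramsey statements for lists, and halving by majority

ConstantOn : (List V → Bool) → ℕ → Bool → List V → Set
ConstantOn χ a c H = ∀ {xs} → xs ⊆ H → length xs ≡ a → χ xs ≡ c

-- Quantifying over `V` and `L` allows an application to a list of picked vertices, with a coloring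
-- derived from `χ`.
Ramsey : ℕ → ℕ → ℕ → Set₁
Ramsey N a k = ∀ {V : Set} (χ : List V → Bool) (L : List V) → N ≤ length L →
  ∃[ H ] H ⊆ L × length H ≡ k × ∃[ c ] ConstantOn χ a c H

-- Picks accumulate at the head of a list, so homogeneous lists arise in reverse order, for `χ`
-- composed with `reverse`; this undoes the reversal.
ConstantOn-reverse : ∀ (χ : List V → Bool) {a c} H →
  ConstantOn (λ xs → χ (reverse xs)) a c H → ConstantOn χ a c (reverse H)
ConstantOn-reverse χ H const {xs} xs⊆ ∣xs∣≡a = subst (λ ys → χ ys ≡ _) (reverse-involutive xs)
  (const (subst (reverse xs ⊆_) (reverse-involutive H) (reverse⁺ xs⊆))
         (trans (length-reverse xs) ∣xs∣≡a))

-- Setting aside the picked vertex itself costs at most one halving.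
2^-tail : ∀ m {l} → 2 ^ suc m ≤ suc l → 2 ^ m ≤ l
2^-tail m {l} h = +-cancelˡ-≤ 1 (2 ^ m) l (begin
  1 + 2 ^ m        ≤⟨ +-monoˡ-≤ (2 ^ m) (m^n>0 2 m) ⟩
  2 ^ m + 2 ^ m    ≡⟨ cong (2 ^ m +_) (+-identityʳ (2 ^ m)) ⟨
  2 ^ suc m        ≤⟨ h ⟩
  suc l            ∎)
  where open ≤-Reasoning

-- Each element of `S` lowers one of the two thresholds by one, so m + n - 1 elements suffice.
pigeonhole : ∀ (f : V → Bool) S m n → m + n ≤ suc (length S) →
  (∃[ S′ ] S′ ⊆ S × m ≤ length S′ × All (λ y → f y ≡ true) S′) ⊎
  (∃[ S′ ] S′ ⊆ S × n ≤ length S′ × All (λ y → f y ≡ false) S′)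
pigeonhole f S zero    n       h = inj₁ ([] , minimum S , z≤n , [])
pigeonhole f S (suc m) zero    h = inj₂ ([] , minimum S , z≤n , [])
pigeonhole f [] (suc m) (suc n) (s≤s h) with () ← ≤-trans (m≤n+m (suc n) m) h
pigeonhole f (x ∷ S) (suc m) (suc n) (s≤s h) with f x in eq
... | true with pigeonhole f S m (suc n) h
...   | inj₁ (S′ , S′⊆S , m≤ , all) = inj₁ (x ∷ S′ , refl ∷ S′⊆S , s≤s m≤ , eq ∷ all)
...   | inj₂ (S′ , S′⊆S , n≤ , all) = inj₂ (S′ , x ∷ʳ S′⊆S , n≤ , all)
pigeonhole f (x ∷ S) (suc m) (suc n) (s≤s h) | false
  with pigeonhole f S (suc m) n (subst (_≤ suc (length S)) (+-suc m n) h)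
...   | inj₁ (S′ , S′⊆S , m≤ , all) = inj₁ (S′ , x ∷ʳ S′⊆S , m≤ , all)
...   | inj₂ (S′ , S′⊆S , n≤ , all) = inj₂ (x ∷ S′ , refl ∷ S′⊆S , s≤s n≤ , eq ∷ all)

majority : ∀ (f : V → Bool) S m → 2 ^ suc m ≤ length S →
  ∃[ c ] ∃[ S′ ] S′ ⊆ S × 2 ^ m ≤ length S′ × All (λ y → f y ≡ c) S′
majority f S m h with pigeonhole f S (2 ^ m) (2 ^ m)
  (m≤n⇒m≤1+n (subst (_≤ length S) (cong (2 ^ m +_) (+-identityʳ (2 ^ m))) h))
... | inj₁ (S′ , r) = true , S′ , r
... | inj₂ (S′ , r) = false , S′ , r

-- One halving per function; constancy passes to the smaller lists that follow.
homogenize : ∀ (F : List (V → Bool)) S m → 2 ^ (length F + m) ≤ length S →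
  ∃[ S′ ] S′ ⊆ S × 2 ^ m ≤ length S′ × All (λ f → ∃[ c ] All (λ y → f y ≡ c) S′) F
homogenize []      S m h = S , ⊆-refl , h , []
homogenize (f ∷ F) S m h =
  let c , S₁ , S₁⊆S , h₁ , const    = majority f S (length F + m) h
      S₂ , S₂⊆S₁ , h₂ , consts      = homogenize F S₁ m h₁
  in S₂ , ⊆-trans S₂⊆S₁ S₁⊆S , h₂ , (c , All-resp-⊆ S₂⊆S₁ const) ∷ consts

-- Stepping up (Erdős–Rado)

sublists : ℕ → List V → List (List V)
sublists zero    xs       = [] ∷ []
sublists (suc d) []       = []
sublists (suc d) (x ∷ xs) = map (x ∷_) (sublists d xs) ++ sublists (suc d) xs

∈-sublists : ∀ {xs ys : List V} → xs ⊆ ys → xs ∈ sublists (length xs) ys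
∈-sublists []                    = here refl
∈-sublists {xs = []}     (y ∷ʳ τ) = here refl
∈-sublists {xs = x ∷ xs} (y ∷ʳ τ) = ∈-++⁺ʳ _ (∈-sublists τ)
∈-sublists (refl ∷ τ)            = ∈-++⁺ˡ (∈-map⁺ (_ ∷_) (∈-sublists τ))

^-suc-binomial : ∀ i d → i ^ suc d + i ^ d ≤ suc i ^ suc d
^-suc-binomial i d = begin
  i * i ^ d + i ^ d    ≡⟨ +-comm (i * i ^ d) (i ^ d) ⟩
  suc i * i ^ d        ≤⟨ *-monoʳ-≤ (suc i) (^-monoˡ-≤ d (n≤1+n i)) ⟩
  suc i * suc i ^ d    ∎
  where open ≤-Reasoning

-- The power is a crude bound on a binomial coefficient; `^-suc-binomial` carries it through
-- Pascal's rule.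
length-sublists : ∀ d (xs : List V) → length (sublists d xs) ≤ length xs ^ d
length-sublists zero    xs       = ≤-refl
length-sublists (suc d) []       = z≤n
length-sublists (suc d) (x ∷ xs) = begin
  length (map (x ∷_) (sublists d xs) ++ sublists (suc d) xs)
    ≡⟨ length-++ (map (x ∷_) (sublists d xs)) ⟩
  length (map (x ∷_) (sublists d xs)) + length (sublists (suc d) xs)
    ≡⟨ cong (_+ length (sublists (suc d) xs)) (length-map (x ∷_) (sublists d xs)) ⟩
  length (sublists d xs) + length (sublists (suc d) xs)
    ≤⟨ +-mono-≤ (length-sublists d xs) (length-sublists (suc d) xs) ⟩
  length xs ^ d + length xs ^ suc d
    ≡⟨ +-comm (length xs ^ d) (length xs ^ suc d) ⟩
  length xs ^ suc d + length xs ^ d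
    ≤⟨ ^-suc-binomial (length xs) d ⟩
  suc (length xs) ^ suc d ∎
  where open ≤-Reasoning

-- Halvings of the remaining vertices during n picks after the first i: a pick v
-- costs one for its own removal and one for each d-element set X of earlier
-- picks, to make the color of X ∪ {v , y} the same for all remaining y.
cost : ℕ → ℕ → ℕ → ℕ
cost d i zero    = 0
cost d i (suc n) = suc (i ^ d) + cost d (suc i) n

-- As the exponent d + 1 is positive, `i ^ suc d` is strictly below `suc i ^ suc d`. This gap pays
-- for the removal of the pick.
^-suc-step : ∀ i d → i ^ suc (suc d) + suc (i ^ suc d) ≤ suc i ^ suc (suc d)
^-suc-step i d = begin
  i ^ suc (suc d) + suc (i ^ suc d)     ≡⟨ +-comm (i * i ^ suc d) (suc (i ^ suc d)) ⟩
  suc (i ^ suc d + i * i ^ suc d)       ≤⟨ s≤s (*-monoʳ-≤ (suc i) i^≤) ⟩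
  1 + suc i * (suc i ^ suc d ∸ 1)       ≤⟨ +-monoˡ-≤ (suc i * (suc i ^ suc d ∸ 1)) {1} {suc i} (s≤s z≤n) ⟩
  suc i + suc i * (suc i ^ suc d ∸ 1)   ≡⟨ *-suc (suc i) (suc i ^ suc d ∸ 1) ⟨
  suc i * suc (suc i ^ suc d ∸ 1)       ≡⟨ cong (suc i *_) (m+[n∸m]≡n (m^n>0 (suc i) (suc d))) ⟩
  suc i * suc i ^ suc d                 ∎
  where
  open ≤-Reasoning
  i^≤ : i ^ suc d ≤ suc i ^ suc d ∸ 1
  i^≤ = ∸-monoˡ-≤ 1 (^-monoˡ-< (suc d) (n<1+n i))

-- The costs telescope by `^-suc-step`; at i = 0 the first summand vanishes and n picks cost at most
-- n^(d+2).
cost-≤ : ∀ d i n → i ^ suc (suc d) + cost (suc d) i n ≤ (i + n) ^ suc (suc d)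
cost-≤ d i zero    = ≤-reflexive (trans (+-identityʳ _) (cong (_^ suc (suc d)) (sym (+-identityʳ i))))
cost-≤ d i (suc n) = begin
  i ^ suc (suc d) + (suc (i ^ suc d) + cost (suc d) (suc i) n)
    ≡⟨ +-assoc (i ^ suc (suc d)) (suc (i ^ suc d)) (cost (suc d) (suc i) n) ⟨
  i ^ suc (suc d) + suc (i ^ suc d) + cost (suc d) (suc i) n
    ≤⟨ +-monoˡ-≤ (cost (suc d) (suc i) n) (^-suc-step i d) ⟩
  suc i ^ suc (suc d) + cost (suc d) (suc i) n
    ≤⟨ cost-≤ d (suc i) n ⟩
  (suc i + n) ^ suc (suc d)
    ≡⟨ cong (_^ suc (suc d)) (+-suc i n) ⟨
  (i + suc n) ^ suc (suc d) ∎
  where open ≤-Reasoning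

-- The colored sets have d + 2 elements. The picks are made so that the color of a set stops
-- depending on its last vertex.
module EndHomogeneous (φ : List V → Bool) (d : ℕ) (L : List V) where

  -- Lists of picks are in reverse order.
  Undecided : List V → List V → Set
  Undecided P S = ∀ {y z xs} → y ∈ S → z ∈ S → xs ⊆ P → length xs ≡ suc d → φ (y ∷ xs) ≡ φ (z ∷ xs)

  -- Here `y` is itself a pick; any remaining vertex may stand in for it.
  Decided : List V → List V → Set
  Decided P S = ∀ {y z xs} → (y ∷ xs) ⊆ P → z ∈ S → length xs ≡ suc d → φ (y ∷ xs) ≡ φ (z ∷ xs)

  record State (P S : List V) : Set where
    field
      within    : P ʳ++ S ⊆ L
      decided   : Decided P S
      undecided : Undecided P S

  pick : ∀ {P v S} m → State P (v ∷ S) → 2 ^ (suc (length P ^ d) + m) ≤ suc (length S) →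
    ∃[ S′ ] 2 ^ m ≤ length S′ × State (v ∷ P) S′
  pick {P} {v} {S} m st h with homogenize (map (λ xs y → φ (y ∷ v ∷ xs)) (sublists d P)) S m
    (≤-trans (^-monoʳ-≤ 2 (+-monoˡ-≤ m (≤-trans (≤-reflexive (length-map _ (sublists d P)))
      (length-sublists d P)))) (2^-tail (length P ^ d + m) h))
  ... | S′ , S′⊆S , h′ , consts = S′ , h′ , record
    { within    = ⊆-trans (ʳ++⁺ {as = P} ⊆-refl (refl ∷ S′⊆S)) within
    ; decided   = λ { (_ ∷ʳ τ) z∈ l → decided τ (there (lookup S′⊆S z∈)) l
                    -- Until this pick `v` was a remaining vertex, so the old `undecided` already
                    -- compares it with `z`.
                    ; (refl ∷ τ) z∈ l → undecided (here refl) (there (lookup S′⊆S z∈)) τ l }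
    ; undecided = λ { y∈ z∈ (_ ∷ʳ τ) l →
                        undecided (there (lookup S′⊆S y∈)) (there (lookup S′⊆S z∈)) τ l
                    -- The set contains `v`; its other d picks index one of the functions just made
                    -- constant on `S′`.
                    ; {xs = _ ∷ xs} y∈ z∈ (refl ∷ τ) refl →
                        let c , const = All.lookup consts (∈-map⁺ _ (∈-sublists τ))
                        in trans (All.lookup const y∈) (sym (All.lookup const z∈)) }
    }
    where open State st

  build : ∀ n {P S} → State P S → 2 ^ cost d (length P) n ≤ length S →
    ∃₂ λ Q T → length Q ≡ length P + n × 1 ≤ length T × State Q T
  build zero    {P} {S} st h = P , S , sym (+-identityʳ (length P)) , h , st
  build (suc n) {P} {[]} st h with () ← ≤-trans (m^n>0 2 (cost d (length P) (suc n))) h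
  build (suc n) {P} {v ∷ S} st h =
    let S′ , h′ , st′         = pick (cost d (suc (length P)) n) st h
        Q , T , ∣Q∣ , T≥1 , r = build n st′ h′
    in Q , T , trans ∣Q∣ (sym (+-suc (length P) n)) , T≥1 , r

-- After n picks one vertex `w` remains. Coloring a set of picks by the color it gets together with
-- `w`, the hypothesis yields k picks; every color among them is the color with the last vertex
-- replaced by `w`, so `w` can be added as the (k+1)-st.
step-up : ∀ {n d k} → Ramsey n (suc (suc d)) k → Ramsey (2 ^ (n ^ suc (suc d))) (3 + d) (suc k)
step-up {n} {d} {k} ramsey χ L h
  with EndHomogeneous.build φ (suc d) L n {[]} {L} start
         (≤-trans (^-monoʳ-≤ 2 (cost-≤ d 0 n)) h)
  where
  φ : List _ → Bool
  φ xs = χ (reverse xs)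
  start : EndHomogeneous.State φ (suc d) L [] L
  start = record { within = ⊆-refl ; decided = λ () ; undecided = λ { _ _ [] () } }
... | P , [] , ∣P∣ , () , st
... | P , w ∷ T , ∣P∣ , _ , st
  with ramsey (λ xs → χ (reverse (w ∷ xs))) P (≤-reflexive (sym ∣P∣))
...   | H , H⊆P , ∣H∣ , c , const =
  reverse (w ∷ H) ,
  ⊆-trans (ʳ++⁺ H⊆P (refl ∷ minimum T)) within ,
  trans (length-reverse (w ∷ H)) (cong suc ∣H∣) ,
  c , ConstantOn-reverse χ (w ∷ H) const′
  where
  open EndHomogeneous.State st
  const′ : ConstantOn (λ xs → χ (reverse xs)) (3 + d) c (w ∷ H)
  const′ {[]} _ ()
  -- The set avoids `w`: exchange its last pick `y` for `w`.
  const′ {y ∷ xs} (_ ∷ʳ τ) l = trans (decided (⊆-trans τ H⊆P) (here refl) (suc-injective l))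
    (const (⊆-trans (_ ∷ʳ ⊆-refl) τ) (suc-injective l))
  const′ {y ∷ xs} (refl ∷ τ) l = const τ (suc-injective l)

-- Triples (Conlon–Fox–Sudakov)

-- The number of nodes that fit below a leaf with `r` left and `b` right turns missing. It is C(r+b,
-- r) - 1 by `slots-!`.
slots : ℕ → ℕ → ℕ
slots zero    b       = 0
slots (suc r) zero    = 0
slots (suc r) (suc b) = suc (slots r (suc b) + slots (suc r) b)

module OnlineTree (φ : List V → Bool) (L : List V) (n : ℕ) where

  -- A later pick goes left of v if all triples of the two with still later
  -- vertices have color true, and right if they all have color false.  The
  -- indices count the left and right turns still missing for a win.
  data Tree : ℕ → ℕ → Set where
    leaf : ∀ {r b} → Tree r b
    node : ∀ {r b} → V → Tree r (suc b) → Tree (suc r) b → Tree (suc r) (suc b)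

  free : ∀ {r b} → Tree r b → ℕ
  free {r} {b} leaf  = slots r b
  free (node v t u)  = free t + free u

  -- `P` is homogeneous together with any one remaining vertex, which is why n turns give n + 1
  -- elements in `win`.
  record Chain (c : Bool) (r : ℕ) (P S : List V) : Set where
    field
      size   : length P + r ≡ n
      within : P ʳ++ S ⊆ L
      const  : ∀ {w} → w ∈ S → ConstantOn φ 3 c (w ∷ P)

  -- `P` and `Q` collect the vertices at which the path from the root turns left and right.
  Valid : ∀ {r b} → Tree r b → (P Q S : List V) → Set
  Valid {r} {b} leaf P Q S = Chain true r P S × Chain false b Q S
  Valid (node v t u) P Q S = Valid t (v ∷ P) Q S × Valid u P (v ∷ Q) S

  Chain-resp-⊆ : ∀ {c r P S S′} → S′ ⊆ S → Chain c r P S → Chain c r P S′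
  Chain-resp-⊆ {P = P} τ ch = record
    { size = size ; within = ⊆-trans (ʳ++⁺ {as = P} ⊆-refl τ) within ; const = λ w∈ → const (lookup τ w∈) }
    where open Chain ch

  Valid-resp-⊆ : ∀ {r b} (t : Tree r b) {P Q S S′} → S′ ⊆ S → Valid t P Q S → Valid t P Q S′
  Valid-resp-⊆ leaf         τ (ch , ch′) = Chain-resp-⊆ τ ch , Chain-resp-⊆ τ ch′
  Valid-resp-⊆ (node v t u) τ (vt , vu)  = Valid-resp-⊆ t τ vt , Valid-resp-⊆ u τ vu

  Win : Set
  Win = ∃[ H ] reverse H ⊆ L × length H ≡ suc n × ∃[ c ] ConstantOn φ 3 c H

  win : ∀ {c P w S} → Chain c 0 P (w ∷ S) → Win
  win {c} {P} {w} {S} ch = w ∷ P , ⊆-trans (ʳ++⁺ {as = P} ⊆-refl (refl ∷ minimum S)) within ,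
    cong suc (trans (sym (+-identityʳ (length P))) size) , c , const (here refl)
    where open Chain ch

  -- Records the turns taken so far by `w`, the vertex being inserted: `true` over `P`, `false` over
  -- `Q`.
  Exposed : Bool → V → List V → List V → Set
  Exposed c w P S = All (λ u → All (λ z → φ (z ∷ w ∷ u ∷ []) ≡ c) S) P

  extend : ∀ {c r P w S S′} → S′ ⊆ S → Exposed c w P S′ → Chain c (suc r) P (w ∷ S) → Chain c r (w ∷ P) S′
  extend {c} {r} {P} {w} {S} {S′} τ exposed ch = record
    { size   = trans (sym (+-suc (length P) r)) size
    ; within = ⊆-trans (ʳ++⁺ {as = P} ⊆-refl (refl ∷ τ)) within
    ; const  = const′
    }
    where
    open Chain ch
    const′ : ∀ {z} → z ∈ S′ → ConstantOn φ 3 c (z ∷ w ∷ P)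
    -- Both `w` and `z` were remaining before, so the old chain covers triples that omit one of
    -- them. Only triples of `z`, `w` and some `u` in `P` are new, and these are exposed.
    const′ z∈ (_ ∷ʳ σ) l               = const (here refl) σ l
    const′ z∈ (refl ∷ _ ∷ʳ σ) l        = const (there (lookup τ z∈)) (refl ∷ σ) l
    const′ {z} z∈ {_ ∷ _ ∷ u ∷ []} (refl ∷ refl ∷ σ) l = All.lookup (All.lookup exposed (to∈ σ)) z∈

  -- Each node on the path of `w` costs one halving and supplies one missing turn, so r + b halvings
  -- suffice. The chains refer to `w ∷ S₀`, the vertices before the insertion, until `w` reaches its
  -- leaf.
  insert : ∀ {r b} (t : Tree r b) {P Q w S S₀} m → S ⊆ S₀ → Valid t P Q (w ∷ S₀) →
    Exposed true w P S → Exposed false w Q S → 2 ^ (r + b + m) ≤ length S →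
    Win ⊎ ∃[ S′ ] S′ ⊆ S × 2 ^ m ≤ length S′ × ∃[ t′ ] suc (free {r} {b} t′) ≤ free t × Valid t′ P Q S′
  insert {zero}          leaf m σ (ch , _) _ _ h = inj₁ (win ch)
  insert {suc r} {zero}  leaf m σ (_ , ch) _ _ h = inj₁ (win ch)
  -- The new node takes one slot, and its two leaves have the others by the recursion of `slots`.
  insert {suc r} {suc b} leaf {w = w} {S} m σ (ch , ch′) ex ex′ h = inj₂ (S , ⊆-refl ,
    ≤-trans (^-monoʳ-≤ 2 (m≤n+m m (suc r + suc b))) h , node w leaf leaf , ≤-refl ,
    (extend σ ex ch , Chain-resp-⊆ (w ∷ʳ σ) ch′) , (Chain-resp-⊆ (w ∷ʳ σ) ch , extend σ ex′ ch′))
  insert {suc r} {suc b} (node v t u) {w = w} {S} m σ (vt , vu) ex ex′ h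
    with majority (λ z → φ (z ∷ w ∷ v ∷ [])) S (r + suc b + m) h
  ... | true , S₁ , τ , h₁ , new
    with insert t m (⊆-trans τ σ) vt (new ∷ All.map (All-resp-⊆ τ) ex) (All.map (All-resp-⊆ τ) ex′) h₁
  ...   | inj₁ x = inj₁ x
  ...   | inj₂ (S₂ , τ₂ , h₂ , t′ , fewer , vt′) = inj₂ (S₂ , ⊆-trans τ₂ τ , h₂ , node v t′ u ,
    +-monoˡ-≤ (free u) fewer , vt′ , Valid-resp-⊆ u (w ∷ʳ ⊆-trans τ₂ (⊆-trans τ σ)) vu)
  insert {suc r} {suc b} (node v t u) {w = w} {S} m σ (vt , vu) ex ex′ h | false , S₁ , τ , h₁ , new
    with insert u m (⊆-trans τ σ) vu (All.map (All-resp-⊆ τ) ex) (new ∷ All.map (All-resp-⊆ τ) ex′)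
      (subst (λ k → 2 ^ (k + m) ≤ length S₁) (+-suc r b) h₁)
  ...   | inj₁ x = inj₁ x
  ...   | inj₂ (S₂ , τ₂ , h₂ , u′ , fewer , vu′) = inj₂ (S₂ , ⊆-trans τ₂ τ , h₂ , node v t u′ ,
    subst (_≤ free t + free u) (+-suc (free t) (free u′)) (+-monoʳ-≤ (free t) fewer) ,
    Valid-resp-⊆ t (w ∷ʳ ⊆-trans τ₂ (⊆-trans τ σ)) vt , vu′)

  -- Without free slots even the leftmost leaf has no turn missing on one side, and any remaining
  -- vertex completes that chain.
  full : ∀ {r b} (t : Tree r b) {P Q w S} → free t ≡ 0 → Valid t P Q (w ∷ S) → Win
  full {zero}         leaf _ (ch , _) = win ch
  full {suc r} {zero} leaf _ (_ , ch) = win ch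
  full (node v t u) eq (vt , _)       = full t (m+n≡0⇒m≡0 (free t) eq) vt

  -- Each round fills a slot. It costs one halving for the removal of `w` and at most 2n for its
  -- path.
  run : ∀ g {S} (t : Tree n n) → free t ≤ g → Valid t [] [] S → 2 ^ (g * suc (n + n)) ≤ length S → Win
  run g {[]} t _ _ h with () ← ≤-trans (m^n>0 2 (g * suc (n + n))) h
  run zero    {w ∷ S} t t≤ vt h = full t (n≤0⇒n≡0 t≤) vt
  run (suc g) {w ∷ S} t t≤ vt h
    with insert t (g * suc (n + n)) ⊆-refl vt [] [] (2^-tail (n + n + g * suc (n + n)) h)
  ... | inj₁ x = x
  ... | inj₂ (S′ , _ , h′ , t′ , fewer , vt′) = run g t′ (s≤s⁻¹ (≤-trans fewer t≤)) vt′ h′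

  start : Valid {n} {n} leaf [] [] L
  start = chain , chain
    where
    chain : ∀ {c} → Chain c n [] L
    chain = record { size = refl ; within = ⊆-refl
                   ; const = λ { _ (_ ∷ʳ []) () ; _ (refl ∷ []) () } }

ramsey₃ : ∀ n → Ramsey (2 ^ (slots n n * suc (n + n))) 3 (suc n)
ramsey₃ n χ L h =
  let H , H⊆L , ∣H∣ , c , const = run (slots n n) leaf ≤-refl start h
  in reverse H , H⊆L , trans (length-reverse H) ∣H∣ , c , ConstantOn-reverse χ H const
  where open OnlineTree (λ xs → χ (reverse xs)) L n

-- Sublists and subsets

select : ∀ {V : Set} {n} → (Fin n → V) → Subset n → List V
select f []            = []
select f (inside  ∷ A) = f zero ∷ select (f ∘ suc) A
select f (outside ∷ A) = select (f ∘ suc) A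

length-select : ∀ {V : Set} {n} (f : Fin n → V) A → length (select f A) ≡ ∣ A ∣
length-select f []            = refl
length-select f (inside  ∷ A) = cong suc (length-select (f ∘ suc) A)
length-select f (outside ∷ A) = length-select (f ∘ suc) A

select-⊆ : ∀ {V : Set} {n} (f : Fin n → V) {A H} → A Subset.⊆ H → select f A ⊆ select f H
select-⊆ f {[]}          {[]}          A⊆H = []
select-⊆ f {outside ∷ A} {outside ∷ H} A⊆H = select-⊆ (f ∘ suc) (drop-∷-⊆ A⊆H)
select-⊆ f {outside ∷ A} {inside  ∷ H} A⊆H = f zero ∷ʳ select-⊆ (f ∘ suc) (drop-∷-⊆ A⊆H)
select-⊆ f {inside  ∷ A} {inside  ∷ H} A⊆H = refl ∷ select-⊆ (f ∘ suc) (drop-∷-⊆ A⊆H)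
select-⊆ f {inside  ∷ A} {outside ∷ H} A⊆H with () ← A⊆H here

sublist-select : ∀ {V : Set} {n} (f : Fin n → V) {H} → H ⊆ tabulate f → ∃[ A ] select f A ≡ H
sublist-select {n = zero}  f []         = [] , refl
sublist-select {n = suc n} f (_ ∷ʳ τ)   = let A , eq = sublist-select (f ∘ suc) τ in outside ∷ A , eq
sublist-select {n = suc n} f (refl ∷ τ) = let A , eq = sublist-select (f ∘ suc) τ in inside ∷ A , cong (f zero ∷_) eq

⋃-outside : ∀ {m n} (g : Fin m → Subset n) A →
  ⋃ (select (λ i → outside ∷ g i) A) ≡ outside ∷ ⋃ (select g A)
⋃-outside g []            = refl
⋃-outside g (inside  ∷ A) = cong ((outside ∷ g zero) Subset.∪_) (⋃-outside (g ∘ suc) A)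
⋃-outside g (outside ∷ A) = ⋃-outside (g ∘ suc) A

⋃-singletons : ∀ {n} (A : Subset n) → ⋃ (select ⁅_⁆ A) ≡ A
⋃-singletons []            = refl
⋃-singletons (inside  ∷ A) = trans (cong (⁅ zero ⁆ Subset.∪_) (⋃-outside ⁅_⁆ A))
  (cong (inside ∷_) (trans (∪-identityˡ _) (⋃-singletons A)))
⋃-singletons (outside ∷ A) = trans (⋃-outside ⁅_⁆ A) (cong (outside ∷_) (⋃-singletons A))

-- The default `false` is arbitrary: colors are compared only on subsets of size `a`.
extend-coloring : ∀ {n a} → (Binom n a → Bool) → Subset n → Bool
extend-coloring {a = a} COL A with ∣ A ∣ ≟ a
... | yes p = COL (A , p)
... | no  _ = false

extend-coloring-≡ : ∀ {n a} (COL : Binom n a → Bool) A → extend-coloring COL (proj₁ A) ≡ COL A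
extend-coloring-≡ {a = a} COL (A , p) with ∣ A ∣ ≟ a
... | yes q = cong (λ r → COL (A , r)) (≡-irrelevant q p)
... | no ¬p = contradiction p ¬p

-- Vertices are represented by singletons, so a list of vertices stands for its union, which can be
-- colored directly.
Ramsey⇒Arrows : ∀ {N a k} → Ramsey N a k → Arrows N a k
Ramsey⇒Arrows {N} {a} ramsey COL
  with ramsey (extend-coloring COL ∘ ⋃) (tabulate ⁅_⁆) (≤-reflexive (sym (length-tabulate ⁅_⁆)))
... | _ , H⊆ , ∣H∣ , c , const with sublist-select ⁅_⁆ H⊆
... | H , refl = H , trans (sym (length-select ⁅_⁆ H)) ∣H∣ ,
  λ A A′ A⊆H A′⊆H → trans (color A A⊆H) (sym (color A′ A′⊆H))
  where
  color : ∀ A → proj₁ A Subset.⊆ H → COL A ≡ c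
  color (A , p) A⊆H = begin
    COL (A , p)                               ≡⟨ extend-coloring-≡ COL (A , p) ⟨
    extend-coloring COL A                     ≡⟨ cong (extend-coloring COL) (⋃-singletons A) ⟨
    extend-coloring COL (⋃ (select ⁅_⁆ A))    ≡⟨ const (select-⊆ ⁅_⁆ A⊆H) (trans (length-select ⁅_⁆ A) p) ⟩
    c                                         ∎
    where open ≡-Reasoning

-- Decidability of the arrow relation and existence of the least n

allSubsets? : ∀ {n} {P : Subset n → Set} → (∀ A → Dec (P A)) → Dec (∀ A → P A)
allSubsets? P? = map′ (λ ¬∃¬ A → decidable-stable (P? A) λ ¬PA → ¬∃¬ (A , ¬PA))
  (λ ∀P (A , ¬PA) → ¬PA (∀P A)) (¬? (anySubset? (λ A → ¬? (P? A))))

join : ∀ {n} → (Subset n → Bool) → (Subset n → Bool) → Subset (suc n) → Bool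
join g h (inside  ∷ A) = g A
join g h (outside ∷ A) = h A

-- A coloring of the subsets of an (n+1)-set splits by membership of the first element. `join`
-- recovers it only pointwise, hence the condition that `Q` respects `≗`.
allColorings? : ∀ n {Q : (Subset n → Bool) → Set} → (∀ g → Dec (Q g)) →
  (∀ {g h} → g ≗ h → Q g → Q h) → Dec (∀ g → Q g)
allColorings? zero {Q} Q? resp = map′
  (λ { (t , f) g → resp (λ { [] → refl }) (at t f (g [])) })
  (λ all → all _ , all _)
  (Q? (λ _ → true) ×-dec Q? (λ _ → false))
  where
  at : Q (λ _ → true) → Q (λ _ → false) → ∀ b → Q (λ _ → b)
  at t f true  = t
  at t f false = f
allColorings? (suc n) {Q} Q? resp = map′
  (λ all g → resp (λ { (inside ∷ A) → refl ; (outside ∷ A) → refl })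
    (all (g ∘ (inside ∷_)) (g ∘ (outside ∷_))))
  (λ all g h → all (join g h))
  (allColorings? n
    (λ g → allColorings? n (λ h → Q? (join g h))
      (λ h≗h′ → resp λ { (inside ∷ A) → refl ; (outside ∷ A) → h≗h′ A }))
    (λ g≗g′ all h → resp (λ { (inside ∷ A) → g≗g′ A ; (outside ∷ A) → refl }) (all h)))

-- This lets `least` find R(a,k) constructively. Colorings of all subsets replace those of
-- `Binom n a`, since they can be enumerated.
Arrows? : ∀ n a k → Dec (Arrows n a k)
Arrows? n a k = map′
  (λ all COL → transfer (extend-coloring-≡ COL) (all (extend-coloring COL)))
  (λ arrows g → arrows (g ∘ proj₁))
  (allColorings? n
    (λ g → anySubset? λ H → (∣ H ∣ ≟ k) ×-dec homogeneous? (g ∘ proj₁) H)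
    (λ g≗h → transfer (g≗h ∘ proj₁)))
  where
  HasHomogeneous : (Binom n a → Bool) → Set
  HasHomogeneous COL = ∃[ H ] ∣ H ∣ ≡ k × Homogeneous COL H

  transfer : ∀ {COL COL′} → COL ≗ COL′ → HasHomogeneous COL → HasHomogeneous COL′
  transfer COL≗ (H , ∣H∣ , hom) = H , ∣H∣ , λ A A′ A⊆H A′⊆H →
    trans (sym (COL≗ A)) (trans (hom A A′ A⊆H A′⊆H) (COL≗ A′))

  homogeneous? : ∀ (COL : Binom n a → Bool) H → Dec (Homogeneous COL H)
  homogeneous? COL H = map′
    (λ all (A , p) (A′ , p′) A⊆H A′⊆H → all A A′ p p′ A⊆H A′⊆H)
    (λ hom A A′ p p′ → hom (A , p) (A′ , p′))
    (allSubsets? λ A → allSubsets? λ A′ → given (∣ A ∣ ≟ a) λ p → given (∣ A′ ∣ ≟ a) λ p′ →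
      (A ⊆? H) →-dec ((A′ ⊆? H) →-dec (COL (A , p) ≟ᵇ COL (A′ , p′))))
    where
    given : ∀ {i j : ℕ} {P : i ≡ j → Set} → Dec (i ≡ j) → (∀ p → Dec (P p)) → Dec (∀ p → P p)
    given {P = P} (yes p) P? = map′ (λ Pp q → subst P (≡-irrelevant p q) Pp) (λ all → all p) (P? p)
    given         (no ¬p) P? = yes λ p → contradiction p ¬p

least : ∀ {P : ℕ → Set} → (∀ n → Dec (P n)) → ∀ N → P N →
  ∃[ n ] n ≤ N × P n × (∀ m → P m → n ≤ m)
least P? N PN with P? 0
least P? N PN | yes P0 = 0 , z≤n , P0 , λ _ _ → z≤n
least P? zero PN | no ¬P0 = contradiction PN ¬P0
least {P} P? (suc N) PN | no ¬P0 =
  let n , n≤N , Pn , min = least (P? ∘ suc) N PN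
  in suc n , s≤s n≤N , Pn , λ { zero P0 → contradiction P0 ¬P0 ; (suc m) Pm → s≤s (min m Pm) }

Arrows⇒IsR : ∀ {N a k} → Arrows N a k → ∃[ n ] IsR a k n × n ≤ N
Arrows⇒IsR {N} {a} {k} arrows =
  let n , n≤N , r = least (λ n → Arrows? n a k) N arrows in n , r , n≤N

-- Numerical estimates

-- Pascal's rule for C(r+b, r), cleared of denominators.
slots-! : ∀ r b → r ! * b ! * suc (slots r b) ≡ (r + b) !
slots-! zero b = trans (*-identityʳ _) (+-identityʳ (b !))
slots-! (suc r) zero = trans (*-identityʳ _) (trans (*-identityʳ _) (cong _! (sym (+-identityʳ (suc r)))))
slots-! (suc r) (suc b) = begin
  suc r ! * suc b ! * suc (suc (slots r (suc b) + slots (suc r) b))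
    ≡⟨ solve 6 (λ r b x y s t →
         (con 1 :+ r) :* x :* ((con 1 :+ b) :* y) :* (con 2 :+ (s :+ t)) :=
         (con 1 :+ r) :* (x :* ((con 1 :+ b) :* y) :* (con 1 :+ s)) :+
         (con 1 :+ b) :* ((con 1 :+ r) :* x :* y :* (con 1 :+ t)))
       refl r b (r !) (b !) (slots r (suc b)) (slots (suc r) b) ⟩
  suc r * (r ! * suc b ! * suc (slots r (suc b))) + suc b * (suc r ! * b ! * suc (slots (suc r) b))
    ≡⟨ cong₂ (λ x y → suc r * x + suc b * y) (slots-! r (suc b)) (slots-! (suc r) b) ⟩
  suc r * (r + suc b) ! + suc b * (suc r + b) !
    ≡⟨ cong (λ z → suc r * (r + suc b) ! + suc b * z !) (+-suc r b) ⟨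
  suc r * (r + suc b) ! + suc b * (r + suc b) !
    ≡⟨ *-distribʳ-+ ((r + suc b) !) (suc r) (suc b) ⟨
  (suc r + suc b) * (r + suc b) ! ∎
  where
  open ≡-Reasoning
  open +-*-Solver

-- The bound C(2n,n)² (2n+1) ≤ 16^n, cleared of denominators, by induction on n.
central-! : ∀ n → (n + n) ! * (n + n) ! * suc (n + n) ≤ 16 ^ n * (n ! * n ! * (n ! * n !))
central-! zero = ≤-refl
central-! (suc n) = begin
  (suc n + suc n) ! * (suc n + suc n) ! * suc (suc n + suc n)
    ≡⟨ cong (λ m → suc m ! * suc m ! * suc (suc m)) (+-suc n n) ⟩
  suc (suc (n + n)) ! * suc (suc (n + n)) ! * suc (suc (suc (n + n)))
    ≡⟨ solve 2 (λ m x → (con 2 :+ m) :* ((con 1 :+ m) :* x) :* ((con 2 :+ m) :* ((con 1 :+ m) :* x)) :* (con 3 :+ m) :=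
         x :* x :* (con 1 :+ m) :* ((con 2 :+ m) :* (con 2 :+ m) :* ((con 1 :+ m) :* (con 3 :+ m))))
       refl (n + n) ((n + n) !) ⟩
  (n + n) ! * (n + n) ! * suc (n + n) * ((2 + (n + n)) * (2 + (n + n)) * ((1 + (n + n)) * (3 + (n + n))))
    ≤⟨ *-mono-≤ (central-! n) (*-monoʳ-≤ ((2 + (n + n)) * (2 + (n + n)))
         -- (2n+1)(2n+3) is one less than (2n+2)².
         (≤-trans (n≤1+n _) (≤-reflexive
           (solve 1 (λ n → con 1 :+ (con 1 :+ (n :+ n)) :* (con 3 :+ (n :+ n)) :=
             con 4 :* ((con 1 :+ n) :* (con 1 :+ n))) refl n)))) ⟩
  16 ^ n * (n ! * n ! * (n ! * n !)) * ((2 + (n + n)) * (2 + (n + n)) * (4 * (suc n * suc n)))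
    ≡⟨ solve 3 (λ n p y → p :* (y :* y :* (y :* y)) :* ((con 2 :+ (n :+ n)) :* (con 2 :+ (n :+ n)) :* (con 4 :* ((con 1 :+ n) :* (con 1 :+ n)))) :=
         (con 16 :* p) :* ((con 1 :+ n) :* y :* ((con 1 :+ n) :* y) :* ((con 1 :+ n) :* y :* ((con 1 :+ n) :* y))))
       refl n (16 ^ n) (n !) ⟩
  16 ^ suc n * (suc n ! * suc n ! * (suc n ! * suc n !)) ∎
  where
  open ≤-Reasoning
  open +-*-Solver

slots-central : ∀ n → suc (slots n n) * suc (slots n n) * suc (n + n) ≤ 16 ^ n
slots-central n = *-cancelʳ-≤ _ _ (y * y * (y * y)) {{>-nonZero (*-mono-≤ y²≥1 y²≥1)}} (begin
  s * s * suc (n + n) * (y * y * (y * y))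
    ≡⟨ solve 3 (λ s m y → s :* s :* m :* (y :* y :* (y :* y)) := y :* y :* s :* (y :* y :* s) :* m)
       refl s (suc (n + n)) y ⟩
  y * y * s * (y * y * s) * suc (n + n)
    ≡⟨ cong (λ z → z * z * suc (n + n)) (slots-! n n) ⟩
  (n + n) ! * (n + n) ! * suc (n + n)
    ≤⟨ central-! n ⟩
  16 ^ n * (y * y * (y * y)) ∎)
  where
  open ≤-Reasoning
  open +-*-Solver
  s = suc (slots n n)
  y = n !
  y²≥1 : 1 ≤ y * y
  y²≥1 = *-mono-≤ (1≤n! n) (1≤n! n)

tripleBits : ℕ → ℕ
tripleBits n = slots n n * suc (n + n)

-- That is, tripleBits n / 4^(n+1) ≤ ½ √n.
tripleBits-bound : ∀ n → 4 * (tripleBits n * tripleBits n) ≤ n * (4 ^ suc n * 4 ^ suc n)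
tripleBits-bound zero = z≤n
tripleBits-bound n@(suc n′) = begin
  4 * (s * m * (s * m))             ≡⟨ solve 2 (λ s m → con 4 :* (s :* m :* (s :* m)) := s :* s :* m :* (con 4 :* m)) refl s m ⟩
  s * s * m * (4 * m)               ≤⟨ *-mono-≤ (≤-trans (*-monoˡ-≤ m (*-mono-≤ (n≤1+n s) (n≤1+n s))) (slots-central n)) (*-monoʳ-≤ 4 m≤4n) ⟩
  16 ^ n * (4 * (4 * n))            ≡⟨ cong (_* (4 * (4 * n))) 16^≡ ⟩
  4 ^ n * 4 ^ n * (4 * (4 * n))     ≡⟨ solve 2 (λ p n → p :* p :* (con 4 :* (con 4 :* n)) := n :* ((con 4 :* p) :* (con 4 :* p))) refl (4 ^ n) n ⟩
  n * (4 ^ suc n * 4 ^ suc n)       ∎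
  where
  open ≤-Reasoning
  open +-*-Solver
  s = slots n n
  m = suc (n + n)
  m≤4n : m ≤ 4 * n
  m≤4n = ≤-trans (m≤m+n m (suc (n′ + n′))) (≤-reflexive
    (solve 1 (λ n′ → con 1 :+ ((con 1 :+ n′) :+ (con 1 :+ n′)) :+ (con 1 :+ (n′ :+ n′)) := con 4 :* (con 1 :+ n′)) refl n′))
  16^≡ : 16 ^ n ≡ 4 ^ n * 4 ^ n
  16^≡ = trans (^-*-assoc 4 2 n)
    (trans (cong (λ l → 4 ^ (n + l)) (+-identityʳ n)) (^-distribˡ-+-* 4 n n))

ι-* : ∀ k l → ι (k * l) ≡ ι k ℚ.* ι l
ι-* k l = trans (cong ιℤ (ℤ.pos-* k l)) (ιℤ-* (ℤ.+ k) (ℤ.+ l))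

ι-2^ : ∀ n → ι (2 ^ n) ≡ 2ℚ ^ℚ n
ι-2^ zero    = refl
ι-2^ (suc n) = trans (ι-* 2 (2 ^ n)) (cong (2ℚ ℚ.*_) (ι-2^ n))

-- Rational bounds on real numbers

infix 4 _≼_ _≽_

-- The inequality a ≤ x, tested on right ends of intervals. All estimates compare a real with a
-- rational.
record _≼_ (a : ℚ) (x : ℝ) : Set where
  constructor lower
  field ≤upper : ∀ {p q} → Within x p q → a ℚ.≤ q

record _≽_ (a : ℚ) (x : ℝ) : Set where
  constructor upper
  field lower≤ : ∀ {p q} → Within x p q → p ℚ.≤ a

open _≼_
open _≽_

≼-weaken : ∀ {a b x} → a ℚ.≤ b → b ≼ x → a ≼ x
≼-weaken a≤b b≼x = lower λ w → ℚ.≤-trans a≤b (≤upper b≼x w)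

≼-fromℚ : ∀ a → a ≼ fromℚ a
≼-fromℚ a = lower λ { (_ , refl) → ℚ.≤-refl }

-- A product interval contains the product of the two right ends, which are at least `a` and `b`.
≼-* : ∀ {a b} x y → 0ℚ ℚ.≤ a → 0ℚ ℚ.≤ b → a ≼ x → b ≼ y → a ℚ.* b ≼ x *ᴿ y
≼-* x y 0≤a 0≤b a≼x b≼y = lower λ { (p , q , r , u , x∈ , y∈ , bnd) →
  ℚ.≤-trans (*-mono 0≤a (ℚ.≤-trans 0≤b (≤upper b≼y y∈)) (≤upper a≼x x∈) (≤upper b≼y y∈))
            (proj₂ (bnd (meet x x∈ x∈) ℚ.≤-refl (meet y y∈ y∈) ℚ.≤-refl)) }

≼-√ : ∀ {a} x → a ℚ.* a ≼ x → a ≼ √ x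
≼-√ x a²≼x = lower λ { (p , q , x∈ , _ , 0≤t , q≤t²) →
  square-cancel 0≤t (ℚ.≤-trans (≤upper a²≼x x∈) q≤t²) }

√-≽ : ∀ {a} x → 0ℚ ℚ.≤ a → a ℚ.* a ≽ x → a ≽ √ x
√-≽ x 0≤a x≤a² = upper λ
  { (p , q , x∈ , inj₁ s≤0 , _)  → ℚ.≤-trans s≤0 0≤a
  ; (p , q , x∈ , inj₂ s²≤p , _) → square-cancel 0≤a (ℚ.≤-trans s²≤p (lower≤ x≤a² x∈)) }

≼-recip : ∀ {a b} x x>0 → 0ℚ ℚ.≤ b → b ℚ.* a ℚ.≤ 1ℚ → a ≽ x → b ≼ recip x x>0
≼-recip {a} {b} x x>0 0≤b ba≤1 x≤a = lower λ { {_} {t} (p , q , x∈ , 0<p , _ , 1≤tp) →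
  ℚ.*-cancelʳ-≤-pos p {{positive 0<p}}
    (ℚ.≤-trans (*-monoˡ 0≤b (lower≤ x≤a x∈)) (ℚ.≤-trans ba≤1 1≤tp)) }

-- Compare powers whose exponent is the denominator of the right end `q`.
≼-2^ : ∀ {n} x → ι n ≼ x → ι (2 ^ n) ≼ 2^ᴿ x
≼-2^ {n} x n≼x = lower λ { {_} {t} (_ , 0≤t , p , q , x∈ , _ , 2^q≤) →
  ^-cancel (ℚ.ℚ.denominator-1 q) 0≤t (begin
    ι (2 ^ n) ^ℚ ↧ₙ q         ≡⟨ cong (_^ℚ ↧ₙ q) (ι-2^ n) ⟩
    (2ℚ ^ℚ n) ^ℚ ↧ₙ q         ≡⟨ 2^ᶻ-^ (ℤ.+ n) (↧ₙ q) ⟩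
    2^ᶻ (ℤ.+ n ℤ.* ↧ q)       ≤⟨ 2^ᶻ-mono (subst (ℤ.+ n ℤ.* ↧ q ℤ.≤_) (ℤ.*-identityʳ (↥ q)) (ℚ.drop-*≤* (≤upper n≼x x∈))) ⟩
    2^ᶻ (↥ q)                 ≤⟨ 2^q≤ ⟩
    t ^ℚ ↧ₙ q                 ∎) }
  where open ℚ.≤-Reasoning

≼-ι* : ∀ {m n} x y → ι m ≼ x → ι n ≼ y → ι (m * n) ≼ x *ᴿ y
≼-ι* {m} {n} x y m≼x n≼y = subst (_≼ x *ᴿ y) (sym (ι-* m n)) (≼-* x y (0≤ι m) (0≤ι n) m≼x n≼y)

5/2≼e : ℤ.+ 5 ℚ./ 2 ≼ e
-- The partial sum 1 + 1 + 1/2.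
5/2≼e = lower λ w → ℚ.≤-trans (from-yes (ℤ.+ 5 ℚ./ 2 ℚ.≤? e-sum 3)) (meet e (1 , refl , refl) w)

-- The first upper bound π ≤ 4 gives 8; the square 9 is convenient for the root.
2π≤9 : ι 3 ℚ.* ι 3 ≽ fromℕ 2 *ᴿ π
2π≤9 = upper λ { {s} (_ , _ , r , u , (refl , refl) , π∈ , bnd) → begin
  s              ≤⟨ proj₁ (bnd ℚ.≤-refl ℚ.≤-refl ℚ.≤-refl (meet π π∈ π∈)) ⟩
  ι 2 ℚ.* r      ≤⟨ *-monoˡ (0≤ι 2) (meet π π∈ (0 , refl , refl)) ⟩
  ι 2 ℚ.* (leibniz-sum 0 ℚ.+ leibniz⁺ 0)  ≤⟨ from-yes (ι 2 ℚ.* (leibniz-sum 0 ℚ.+ leibniz⁺ 0) ℚ.≤? ι 3 ℚ.* ι 3) ⟩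
  ι 3 ℚ.* ι 3    ∎ }
  where open ℚ.≤-Reasoning

-- e/√(2π) is at least (5/2)/3 = 5/6, and (5/6)³ = 125/216 exceeds ½.
½≼B : ½ ≼ B
½≼B = ≼-weaken (from-yes (½ ℚ.≤? b ℚ.* b ℚ.* b))
  (≼-* (e/√2π *ᴿ e/√2π) e/√2π (from-yes (0ℚ ℚ.≤? b ℚ.* b)) 0≤b (≼-* e/√2π e/√2π 0≤b 0≤b b≼ b≼) b≼)
  where
  b : ℚ
  b = ℤ.+ 5 ℚ./ 2 ℚ.* (ℤ.+ 1 ℚ./ 3)
  0≤b : 0ℚ ℚ.≤ b
  0≤b = from-yes (0ℚ ℚ.≤? b)
  b≼ : b ≼ e/√2π
  b≼ = ≼-* e (recip (√ (fromℕ 2 *ᴿ π)) (√-positive (fromℕ 2 *ᴿ π) 2π-positive))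
    (from-yes (0ℚ ℚ.≤? ℤ.+ 5 ℚ./ 2)) (from-yes (0ℚ ℚ.≤? ℤ.+ 1 ℚ./ 3)) 5/2≼e
    (≼-recip (√ (fromℕ 2 *ᴿ π)) (√-positive (fromℕ 2 *ᴿ π) 2π-positive)
      (from-yes (0ℚ ℚ.≤? ℤ.+ 1 ℚ./ 3)) (from-yes (ℤ.+ 1 ℚ./ 3 ℚ.* ι 3 ℚ.≤? 1ℚ))
      (√-≽ (fromℕ 2 *ᴿ π) (0≤ι 3) 2π≤9))

-- One factor each for B, √n and the power of two. Here a = 2 `tripleBits n` / 4^(n+1), and a² ≤ n
-- is `tripleBits-bound`.
tripleBits-factors : ∀ n → ∃[ a ] 0ℚ ℚ.≤ a × a ≼ √ (fromℕ n) × ι (tripleBits n) ≡ ½ ℚ.* a ℚ.* ι (4 ^ suc n)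
tripleBits-factors n =
  let r , 0<r , rp≡1 = inverse (ℚ.<-≤-trans 0<1 (ι-mono {1} (m^n>0 4 (suc n))))
  in a r , *-nn (*-nn (0≤ι 2) (0≤ι c)) (ℚ.<⇒≤ 0<r) ,
     ≼-√ (fromℕ n) (≼-weaken (square r (ℚ.<⇒≤ 0<r) rp≡1) (≼-fromℚ (ι n))) , product r rp≡1
  where
  open ℚ.≤-Reasoning
  open ℚ.+-*-Solver
  c = tripleBits n
  p = 4 ^ suc n
  a : ℚ → ℚ
  a r = ι 2 ℚ.* ι c ℚ.* r
  square : ∀ r → 0ℚ ℚ.≤ r → r ℚ.* ι p ≡ 1ℚ → a r ℚ.* a r ℚ.≤ ι n
  square r 0≤r rp≡1 = begin
    a r ℚ.* a r
      ≡⟨ solve 2 (λ c r → con (ι 2) :* c :* r :* (con (ι 2) :* c :* r) := con (ι 4) :* (c :* c) :* (r :* r)) refl (ι c) r ⟩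
    ι 4 ℚ.* (ι c ℚ.* ι c) ℚ.* (r ℚ.* r)
      ≡⟨ cong (ℚ._* (r ℚ.* r)) (trans (ι-* 4 (c * c)) (cong (ι 4 ℚ.*_) (ι-* c c))) ⟨
    ι (4 * (c * c)) ℚ.* (r ℚ.* r)
      ≤⟨ *-monoʳ (*-nn 0≤r 0≤r) (ι-mono (tripleBits-bound n)) ⟩
    ι (n * (p * p)) ℚ.* (r ℚ.* r)
      ≡⟨ cong (ℚ._* (r ℚ.* r)) (trans (ι-* n (p * p)) (cong (ι n ℚ.*_) (ι-* p p))) ⟩
    ι n ℚ.* (ι p ℚ.* ι p) ℚ.* (r ℚ.* r)
      ≡⟨ solve 3 (λ n p r → n :* (p :* p) :* (r :* r) := n :* ((r :* p) :* (r :* p))) refl (ι n) (ι p) r ⟩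
    ι n ℚ.* (r ℚ.* ι p ℚ.* (r ℚ.* ι p))
      ≡⟨ cong (λ z → ι n ℚ.* (z ℚ.* z)) rp≡1 ⟩
    ι n ℚ.* (1ℚ ℚ.* 1ℚ)
      ≡⟨ ℚ.*-identityʳ (ι n) ⟩
    ι n ∎
  product : ∀ r → r ℚ.* ι p ≡ 1ℚ → ι c ≡ ½ ℚ.* a r ℚ.* ι p
  product r rp≡1 = begin-equality
    ι c                          ≡⟨ ℚ.*-identityʳ (ι c) ⟨
    ι c ℚ.* 1ℚ                   ≡⟨ cong (ι c ℚ.*_) rp≡1 ⟨
    ι c ℚ.* (r ℚ.* ι p)          ≡⟨ solve 3 (λ c r p → c :* (r :* p) := con ½ :* (con (ι 2) :* c :* r) :* p) refl (ι c) r (ι p) ⟩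
    ½ ℚ.* a r ℚ.* ι p            ∎

4^-≼ : ∀ n → ι (4 ^ suc n) ≼ TOW (fromℕ (2 * suc n)) []
4^-≼ n = subst (λ m → ι m ≼ TOW (fromℕ (2 * suc n)) []) (sym (^-*-assoc 2 2 (suc n)))
  (≼-2^ (fromℕ (2 * suc n)) (≼-fromℚ (ι (2 * suc n))))

tripleBits-≼ : ∀ n → ι (tripleBits n) ≼ B *ᴿ √ (fromℕ n) *ᴿ TOW (fromℕ (2 * suc n)) []
tripleBits-≼ n =
  let a , 0≤a , a≼√ , eq = tripleBits-factors n
  in subst (_≼ B *ᴿ √ (fromℕ n) *ᴿ TOW (fromℕ (2 * suc n)) []) (sym eq)
       (≼-* (B *ᴿ √ (fromℕ n)) (TOW (fromℕ (2 * suc n)) []) (*-nn (ℚ.<⇒≤ 0<½) 0≤a) (0≤ι (4 ^ suc n))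
         (≼-* B (√ (fromℕ n)) (ℚ.<⇒≤ 0<½) 0≤a ½≼B a≼√) (4^-≼ n))

-- The factor 3 comes from cubing `2 ^ tripleBits n` when stepping up from triples.
tripleBits*3-≼ : ∀ n →
  ι (tripleBits n * 3) ≼ fromℕ 3 *ᴿ B *ᴿ √ (fromℕ n) *ᴿ TOW (fromℕ (2 * suc n)) []
tripleBits*3-≼ n =
  let a , 0≤a , a≼√ , eq = tripleBits-factors n
  in subst (_≼ fromℕ 3 *ᴿ B *ᴿ √ (fromℕ n) *ᴿ TOW (fromℕ (2 * suc n)) [])
       (sym (trans (ι-* (tripleBits n) 3) (trans (cong (ℚ._* ι 3) eq)
         (solve 2 (λ a p → con ½ :* a :* p :* con (ι 3) := con (ι 3) :* con ½ :* a :* p) refl a (ι (4 ^ suc n))))))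
       (≼-* (fromℕ 3 *ᴿ B *ᴿ √ (fromℕ n)) (TOW (fromℕ (2 * suc n)) [])
         (*-nn (*-nn (0≤ι 3) (ℚ.<⇒≤ 0<½)) 0≤a) (0≤ι (4 ^ suc n))
         (≼-* (fromℕ 3 *ᴿ B) (√ (fromℕ n)) (*-nn (0≤ι 3) (ℚ.<⇒≤ 0<½)) 0≤a
           (≼-* (fromℕ 3) B (0≤ι 3) (ℚ.<⇒≤ 0<½) (≼-fromℚ (ι 3)) ½≼B) a≼√) (4^-≼ n))
  where open ℚ.+-*-Solver

-- Iterated stepping up and towers

-- R(4 + j, 2 + j + n) ≤ 2 ^ bits n j.
bits : ℕ → ℕ → ℕ
bits n zero    = 2 ^ (tripleBits n * 3)
bits n (suc j) = 2 ^ (bits n j * (4 + j))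

ramsey-bits : ∀ n j → Ramsey (2 ^ bits n j) (4 + j) (2 + j + n)
ramsey-bits n zero    = subst (λ m → Ramsey (2 ^ m) 4 (2 + n)) (^-*-assoc 2 (tripleBits n) 3)
  (step-up (ramsey₃ n))
ramsey-bits n (suc j) = subst (λ m → Ramsey (2 ^ m) (5 + j) (3 + j + n)) (^-*-assoc 2 (bits n j) (4 + j))
  (step-up (ramsey-bits n j))

≼-TOW-∷ : ∀ {m} b c cs → ι m ≼ b *ᴿ TOW c cs → ι (2 ^ m) ≼ TOW b (c ∷ cs)
≼-TOW-∷ {m} b c cs = ≼-2^ {m} (b *ᴿ TOW c cs)

-- A recursion of its own, because unfolding TOW must expose args c m j
-- syntactically: comparing two reals by unfolding them is infeasible.
args : ℝ → ℝ → ℕ → List ℝ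
args c m zero    = c ∷ m ∷ []
args c m (suc j) = fromℕ (4 + j) ∷ args c m j

args-applyDownFrom : ∀ c m j → args c m j ≡ applyDownFrom (λ i → fromℕ (4 + i)) j ++ c ∷ m ∷ []
args-applyDownFrom c m zero    = refl
args-applyDownFrom c m (suc j) = cong (fromℕ (4 + j) ∷_) (args-applyDownFrom c m j)

-- The multiplier `d` is carried along because each level of the tower has its own: 1 at the top,
-- then 4 + j.
bits-≼ : ∀ n c m → ι (tripleBits n * 3) ≼ c *ᴿ TOW m [] →
  ∀ j {d} x → ι d ≼ x → ι (2 ^ (d * bits n j)) ≼ TOW x (args c m j)
bits-≼ n c m h zero {d} x d≼x =
  ≼-TOW-∷ {d * bits n 0} x c (m ∷ []) (≼-ι* {d} {bits n 0} x (TOW c (m ∷ [])) d≼x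
    (≼-TOW-∷ {tripleBits n * 3} c m [] h))
bits-≼ n c m h (suc j) {d} x d≼x =
  ≼-TOW-∷ {d * bits n (suc j)} x (fromℕ (4 + j)) (args c m j)
    (≼-ι* {d} {bits n (suc j)} x (TOW (fromℕ (4 + j)) (args c m j)) d≼x
      (subst (λ l → ι (2 ^ l) ≼ TOW (fromℕ (4 + j)) (args c m j)) (*-comm (4 + j) (bits n j))
        (bits-≼ n c m h j {4 + j} (fromℕ (4 + j)) (≼-fromℚ (ι (4 + j))))))

-- The bounds on R(a,k)

Ramsey⇒R≤ : ∀ {N a k} x → Ramsey N a k → ι N ≼ x → R[ a , k ]≤ x
Ramsey⇒R≤ x ramsey N≼x =
  let n , isR , n≤N = Arrows⇒IsR (Ramsey⇒Arrows ramsey)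
  in n , isR , λ { (refl , _) w → ℚ.≤-trans (ι-mono n≤N) (≤upper N≼x w) }

R₃≤ : ∀ {k} n → suc n ≡ k → R[ 3 , k ]≤ TOW (B *ᴿ √ (fromℕ n)) (fromℕ (2 * k) ∷ [])
R₃≤ n refl = Ramsey⇒R≤ {2 ^ tripleBits n} (TOW (B *ᴿ √ (fromℕ n)) (fromℕ (2 * suc n) ∷ [])) (ramsey₃ n)
  (≼-TOW-∷ {tripleBits n} (B *ᴿ √ (fromℕ n)) (fromℕ (2 * suc n)) [] (tripleBits-≼ n))

R₄₊≤ : ∀ {a k} n j bs → 4 + j ≡ a → 2 + j + n ≡ k →
  args (fromℕ 3 *ᴿ B *ᴿ √ (fromℕ n)) (fromℕ (2 * suc n)) j ≡ bs → R[ a , k ]≤ TOW (fromℕ 1) bs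
R₄₊≤ n j _ refl refl refl = generic (fromℕ 3 *ᴿ B *ᴿ √ (fromℕ n)) (fromℕ (2 * suc n)) (tripleBits*3-≼ n)
  where
  -- With variables `c` and `m` in place of the actual reals there is nothing to unfold.
  generic : ∀ c m → ι (tripleBits n * 3) ≼ c *ᴿ TOW m [] →
    R[ 4 + j , 2 + j + n ]≤ TOW (fromℕ 1) (args c m j)
  generic c m h = Ramsey⇒R≤ {2 ^ bits n j} (TOW (fromℕ 1) (args c m j)) (ramsey-bits n j)
    (subst (λ l → ι (2 ^ l) ≼ TOW (fromℕ 1) (args c m j)) (*-identityˡ (bits n j))
      (bits-≼ n c m h j {1} (fromℕ 1) (≼-fromℚ (ι 1))))

m+n≡l⇒n≡l∸m : ∀ {l} m {n} → m + n ≡ l → n ≡ l ∸ m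
m+n≡l⇒n≡l∸m m {n} refl = sym (m+n∸m≡n m n)

-- n = k - a + 2 and 2(n+1) = 2k - 2a + 6; adding before subtracting keeps truncated subtraction
-- exact.
parameters : ∀ {a k} n j → 4 + j ≡ a → 2 + j + n ≡ k →
  n ≡ k + 2 ∸ a × 2 * suc n ≡ 2 * k + 6 ∸ 2 * a
parameters n j refl refl =
  m+n≡l⇒n≡l∸m (4 + j)
    (solve 2 (λ j n → con 4 :+ j :+ n := con 2 :+ j :+ n :+ con 2) refl j n) ,
  m+n≡l⇒n≡l∸m (2 * (4 + j))
    (solve 2 (λ j n → con 2 :* (con 4 :+ j) :+ con 2 :* (con 1 :+ n) :=
      con 2 :* (con 2 :+ j :+ n) :+ con 6) refl j n)
  where open +-*-Solver

theorem6p6 : (∀ k → 1 ≤ k →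
    R[ 3 , k ]≤ TOW (B *ᴿ √ (fromℕ (k ∸ 1))) (fromℕ (2 * k) ∷ []))
    ×
    (∀ k → 2 ≤ k →
    R[ 4 , k ]≤ TOW (fromℕ 1) (fromℕ 3 *ᴿ B *ᴿ √ (fromℕ (k ∸ 2)) ∷ fromℕ (2 * k ∸ 2) ∷ []))
    ×
    (∀ k → 3 ≤ k →
    R[ 5 , k ]≤ TOW (fromℕ 1) (fromℕ 4 ∷ fromℕ 3 *ᴿ B *ᴿ √ (fromℕ (k ∸ 3)) ∷ fromℕ (2 * k ∸ 4) ∷ []))
    ×
    (∀ a → 6 ≤ a → ∃[ K ] (∀ k → K ≤ k →
    R[ a , k ]≤ TOW (fromℕ 1)
    (applyDownFrom (λ i → fromℕ (4 + i)) (a ∸ 4) ++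
    fromℕ 3 *ᴿ B *ᴿ √ (fromℕ (k + 2 ∸ a)) ∷ fromℕ (2 * k + 6 ∸ 2 * a) ∷ [])))
theorem6p6 = R₃ , R₄ , R₅ , R₆₊
  where
  R₃ : ∀ k → 1 ≤ k → R[ 3 , k ]≤ TOW (B *ᴿ √ (fromℕ (k ∸ 1))) (fromℕ (2 * k) ∷ [])
  R₃ k 1≤k = R₃≤ (k ∸ 1) (m+[n∸m]≡n 1≤k)
  R₄ : ∀ k → 2 ≤ k →
    R[ 4 , k ]≤ TOW (fromℕ 1) (fromℕ 3 *ᴿ B *ᴿ √ (fromℕ (k ∸ 2)) ∷ fromℕ (2 * k ∸ 2) ∷ [])
  R₄ k 2≤k = R₄₊≤ (k ∸ 2) 0 (fromℕ 3 *ᴿ B *ᴿ √ (fromℕ (k ∸ 2)) ∷ fromℕ (2 * k ∸ 2) ∷ [])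
    refl k≡ (cong (λ m → fromℕ 3 *ᴿ B *ᴿ √ (fromℕ (k ∸ 2)) ∷ fromℕ m ∷ [])
      (m+n≡l⇒n≡l∸m 2 (trans (sym (*-suc 2 (suc (k ∸ 2)))) (cong (2 *_) k≡))))
    where
    k≡ : 2 + (k ∸ 2) ≡ k
    k≡ = m+[n∸m]≡n 2≤k
  R₅ : ∀ k → 3 ≤ k →
    R[ 5 , k ]≤ TOW (fromℕ 1) (fromℕ 4 ∷ fromℕ 3 *ᴿ B *ᴿ √ (fromℕ (k ∸ 3)) ∷ fromℕ (2 * k ∸ 4) ∷ [])
  R₅ k 3≤k = R₄₊≤ (k ∸ 3) 1 (fromℕ 4 ∷ fromℕ 3 *ᴿ B *ᴿ √ (fromℕ (k ∸ 3)) ∷ fromℕ (2 * k ∸ 4) ∷ [])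
    refl k≡ (cong (λ m → fromℕ 4 ∷ fromℕ 3 *ᴿ B *ᴿ √ (fromℕ (k ∸ 3)) ∷ fromℕ m ∷ [])
      (m+n≡l⇒n≡l∸m 4 (trans (sym (*-distribˡ-+ 2 2 (suc (k ∸ 3)))) (cong (2 *_) k≡))))
    where
    k≡ : 3 + (k ∸ 3) ≡ k
    k≡ = m+[n∸m]≡n 3≤k
  R₆₊ : ∀ a → 6 ≤ a → ∃[ K ] (∀ k → K ≤ k →
    R[ a , k ]≤ TOW (fromℕ 1)
    (applyDownFrom (λ i → fromℕ (4 + i)) (a ∸ 4) ++
    fromℕ 3 *ᴿ B *ᴿ √ (fromℕ (k + 2 ∸ a)) ∷ fromℕ (2 * k + 6 ∸ 2 * a) ∷ []))
  -- The threshold `K` is a - 2, from which on k - a + 2 is a natural number.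
  R₆₊ a 6≤a = 2 + j , λ k K≤k →
    let n        = k ∸ (2 + j)
        k≡       = m+[n∸m]≡n K≤k
        n≡ , m≡  = parameters n j a≡ k≡
    in R₄₊≤ n j
         (applyDownFrom (λ i → fromℕ (4 + i)) (a ∸ 4) ++
           fromℕ 3 *ᴿ B *ᴿ √ (fromℕ (k + 2 ∸ a)) ∷ fromℕ (2 * k + 6 ∸ 2 * a) ∷ [])
         a≡ k≡
         (trans (args-applyDownFrom (fromℕ 3 *ᴿ B *ᴿ √ (fromℕ n)) (fromℕ (2 * suc n)) j)
           (cong₂ (λ x y → applyDownFrom (λ i → fromℕ (4 + i)) (a ∸ 4) ++
             fromℕ 3 *ᴿ B *ᴿ √ (fromℕ x) ∷ fromℕ y ∷ []) n≡ m≡))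
    where
    j : ℕ
    j = a ∸ 4
    a≡ : 4 + j ≡ a
    a≡ = m+[n∸m]≡n (≤-trans (m≤n+m 4 2) 6≤a)
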